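{- Let $s\ge3$ and $\Gamma_{2,2,s}=\{1324,1423,12\cdots s(s+1)\}$. For $n\ge1$, the coefficient of $y^n$ in $U_{\Gamma_{2,2,s},sn}(-y)$ equals $\prod_{i=1}^n((i-1)s+1)$, and the coefficient of $y^{n+1}$ in $U_{\Gamma_{2,2,s},sn+s-1}(-y)$ equals $\prod_{i=1}^n((i+1)s+1)$.
   Context: $12\cdots s(s+1)$ is the identity of $\mathfrak S_{s+1}$. For $\sigma\in\mathfrak S_n$, $\mathrm{des}(\sigma)$ is the number of $i$ with $\sigma_i>\sigma_{i+1}$. For distinct integers $\alpha=\alpha_1\cdots\alpha_r$, $\mathrm{red}(\alpha)\in\mathfrak S_r$ replaces the $i$-th smallest entry by $i$. $\sigma$ has a $\Gamma$-match starting at position $i$ if there is $j\ge1$ with $\mathrm{red}(\sigma_i\cdots\sigma_{i+j})\in\Gamma$; $\mathcal{NM}_n(\Gamma)$ is the set of $\sigma\in\mathfrak S_n$ with no $\Gamma$-match. The polynomials $U_{\Gamma,n}(y)$ are defined by $\sum_{n\ge0}U_{\Gamma,n}(y)\frac{t^n}{n!}=\left(1+\sum_{n\ge1}\frac{t^n}{n!}\sum_{\sigma\in\mathcal{NM}_n(\Gamma)}y^{1+\mathrm{des}(\sigma)}\right)^{ -1}$. -}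

module Defs where

open import Data.Bool using (Bool; true; false; if_then_else_; _∧_; not)
open import Data.Nat as ℕ using (ℕ; zero; suc; _+_; _∸_; _<ᵇ_; _≡ᵇ_; _≤ᵇ_)
open import Data.Nat.Combinatorics using (_C_)
open import Data.Integer as ℤ using (ℤ; +_; -_)
open import Data.List using (List; []; _∷_; map; concatMap; inits; tails; filterᵇ; length; upTo)
open import Data.Bool.ListAction using (any)
open import Data.List.Properties using (≡-dec)
open import Relation.Nullary.Decidable using (isYes)

-- Permutations of [1..n], written in one-line notation as lists of naturals.
insertions : ℕ → List ℕ → List (List ℕ)
insertions x [] = (x ∷ []) ∷ []
insertions x (y ∷ ys) = (x ∷ y ∷ ys) ∷ map (y ∷_) (insertions x ys)

perms : ℕ → List (List ℕ)
perms zero = [] ∷ []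
perms (suc n) = concatMap (insertions (suc n)) (perms n)

idPerm : ℕ → List ℕ
idPerm k = map suc (upTo k)

des : List ℕ → ℕ
des (x ∷ y ∷ r) = (if y <ᵇ x then 1 else 0) + des (y ∷ r)
des _ = 0

countᵇ : (ℕ → Bool) → List ℕ → ℕ
countᵇ p xs = length (filterᵇ p xs)

red : List ℕ → List ℕ
red α = map (λ x → suc (countᵇ (_<ᵇ x) α)) α

memᵇ : List ℕ → List (List ℕ) → Bool
memᵇ w Γ = any (λ g → isYes (≡-dec ℕ._≟_ g w)) Γ

matchHereᵇ : List (List ℕ) → List ℕ → Bool
matchHereᵇ Γ l = any (λ w → (2 ≤ᵇ length w) ∧ memᵇ (red w) Γ) (inits l)

noMatchᵇ : List (List ℕ) → List ℕ → Bool
noMatchᵇ Γ σ = not (any (matchHereᵇ Γ) (tails σ))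

-- Polynomials in y with integer coefficients, as coefficient functions

Poly : Set
Poly = ℕ → ℤ

sumTo : ℕ → (ℕ → ℤ) → ℤ
sumTo zero f = f 0
sumTo (suc n) f = sumTo n f ℤ.+ f (suc n)

_⊕_ : Poly → Poly → Poly
(p ⊕ q) j = p j ℤ.+ q j

_⊛_ : Poly → Poly → Poly
(p ⊛ q) j = sumTo j (λ i → p i ℤ.* q (j ∸ i))

neg : Poly → Poly
neg p j = - p j

scale : ℕ → Poly → Poly
scale c p j = + c ℤ.* p j

zeroP : Poly
zeroP _ = + 0

oneP : Poly
oneP zero = + 1
oneP (suc _) = + 0

atNeg : Poly → Poly
atNeg p zero = p zero
atNeg p (suc j) = - atNeg (λ k → p (suc k)) j

A : List (List ℕ) → ℕ → Poly
A Γ n j = + length (filterᵇ (λ σ → noMatchᵇ Γ σ ∧ (suc (des σ) ≡ᵇ j)) (perms n))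

-- U_{Γ,n} defined by (1 + Σ_{n≥1} A_n t^n/n!)^{-1} = Σ U_n t^n/n!,
-- i.e. U_0 = 1 and U_n = - Σ_{k=1}^{n} C(n,k) A_k U_{n-k} for n ≥ 1.
-- history Γ n = [U_n, U_{n-1}, ..., U_0]
private
  step : List (List ℕ) → ℕ → ℕ → List Poly → Poly
  -- step Γ m k [U_{m+1-k}, ..., U_0] = Σ_{k' ≥ k} C(m+1,k') A_{k'} U_{m+1-k'}
  step Γ m k [] = zeroP
  step Γ m k (u ∷ us) = scale (suc m C k) (A Γ k ⊛ u) ⊕ step Γ m (suc k) us

history : List (List ℕ) → ℕ → List Poly
history Γ zero = oneP ∷ []
history Γ (suc m) = neg (step Γ m 1 (history Γ m)) ∷ history Γ m

U : List (List ℕ) → ℕ → Poly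
U Γ n with history Γ n
... | [] = zeroP
... | u ∷ _ = u

Γ₂₂ : ℕ → List (List ℕ)
Γ₂₂ s = (1 ∷ 3 ∷ 2 ∷ 4 ∷ []) ∷ (1 ∷ 4 ∷ 2 ∷ 3 ∷ []) ∷ idPerm (suc s) ∷ []

prodFrom1 : ℕ → (ℕ → ℕ) → ℕ
prodFrom1 zero f = 1
prodFrom1 (suc n) f = prodFrom1 n f ℕ.* f (suc n)

{-# OPTIONS --safe #-}
module Submission where

-- Write the reciprocal series as a signed sum over words. A word statistic depending only on relative order
-- is summed over permutations by inserting the largest letter, and this insertion obeys the Leibniz rule for
-- concatenation, so products of exponential generating functions come from convolutions of word statistics.
-- The statistic F, marking Γ-avoiding words by y^(1+des), has a convolution inverse G: a signed sum over cuttings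
-- of the word into increasing bricks of length at most s such that each boundary is either an ascent or the
-- middle of a 1324- or 1423-match. Hence U_n is the sum of G over permutations of length n.
--
-- Since j bricks cover at most s j letters, only the lengths s j and s j - 1 matter here, and there every brick
-- has at least two letters. A boundary ..a b | c.. is then allowed exactly when a < c, so all letters of a brick
-- but its last lie below everything that follows them, while the last one is arbitrary. Stripping the first
-- brick multiplies the count by the number of possible values of its last letter, which gives the products.

open import Defs
open import Data.Bool using (Bool; true; false; T; if_then_else_; _∧_; _∨_; not)
open import Data.Bool.Properties using (T-∧; T-∨; ∧-zeroʳ)
open import Data.Empty using (⊥-elim)
open import Data.Integer as ℤ using (ℤ; +_; -_)
import Data.Integer.Properties as ℤₚ
open import Data.Integer.Tactic.RingSolver using (solve-∀)
open import Data.List using (List; []; _∷_; _++_; map; concatMap; length; filterᵇ; inits; take; drop; applyUpTo)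
open import Data.List.Membership.Propositional using (_∈_; find)
open import Data.List.Membership.Propositional.Properties using (∈-map⁺; ∈-map⁻)
open import Data.List.Properties using (∷-injectiveˡ; ∷-injectiveʳ; length-map; map-upTo; take++drop≡id; map-cong-local; map-∘)
open import Data.List.Relation.Binary.Pointwise as Pointwise using (Pointwise; []; _∷_)
open import Data.List.Relation.Unary.All as All using (All; []; _∷_)
open import Data.List.Relation.Unary.All.Properties using (map⁺; ++⁺)
open import Data.List.Relation.Unary.AllPairs using (AllPairs; []; _∷_)
open import Data.List.Relation.Unary.Any as Any using (here; there)
open import Data.List.Relation.Unary.Any.Properties using (any⁺; any⁻)
open import Data.List.Relation.Unary.Linked using (Linked; []; [-]; _∷_)
open import Data.List.Relation.Unary.Linked.Properties using (Linked⇒AllPairs)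
open import Data.List.Relation.Unary.Unique.Propositional using (Unique)
open import Data.Maybe using (Maybe; just; nothing)
open import Data.Nat as ℕ using (ℕ; zero; suc; _+_; _*_; _∸_; _≤_; _<_; _<ᵇ_; _≡ᵇ_; _≤ᵇ_; z≤n; s≤s)
open import Data.Nat.Combinatorics using (_C_; nCk+nC[k+1]≡[n+1]C[k+1]; k>n⇒nCk≡0)
open import Data.Nat.ListAction using (sum)
open import Data.Nat.Properties as ℕₚ using (≤-refl; ≤-trans)
import Data.Nat.Tactic.RingSolver as ℕ-Solver
open import Data.Product using (∃-syntax; _×_; _,_; proj₁; proj₂)
open import Data.Sum using (inj₁; inj₂)
open import Function using (Equivalence; _∘_)
open import Relation.Binary.Definitions using (tri<; tri≈; tri>)
open import Relation.Binary.PropositionalEquality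
open import Relation.Nullary using (contradiction; yes; no)
open import Relation.Nullary.Decidable using (toWitness; fromWitness)
open ≡-Reasoning

-- Finite sums

sumTo-cong : ∀ n {f g} → (∀ k → k ≤ n → f k ≡ g k) → sumTo n f ≡ sumTo n g
sumTo-cong zero    f≈g = f≈g 0 z≤n
sumTo-cong (suc n) f≈g =
  cong₂ ℤ._+_ (sumTo-cong n (λ k k≤n → f≈g k (ℕₚ.m≤n⇒m≤1+n k≤n))) (f≈g (suc n) ≤-refl)

sumTo-suc : ∀ n f → sumTo (suc n) f ≡ f 0 ℤ.+ sumTo n (λ k → f (suc k))
sumTo-suc zero    f = refl
sumTo-suc (suc n) f = begin
  sumTo (suc n) f ℤ.+ f (2 + n)                             ≡⟨ cong (ℤ._+ f (2 + n)) (sumTo-suc n f) ⟩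
  f 0 ℤ.+ sumTo n (λ k → f (suc k)) ℤ.+ f (2 + n)           ≡⟨ ℤₚ.+-assoc (f 0) _ _ ⟩
  f 0 ℤ.+ sumTo (suc n) (λ k → f (suc k))                   ∎

+-interchange : ∀ a b c d → (a ℤ.+ b) ℤ.+ (c ℤ.+ d) ≡ (a ℤ.+ c) ℤ.+ (b ℤ.+ d)
+-interchange = solve-∀

+≡0⇒≡- : ∀ {x y} → x ℤ.+ y ≡ + 0 → x ≡ - y
+≡0⇒≡- {x} {y} eq = trans (lem x y) (trans (cong (ℤ._+ - y) eq) (ℤₚ.+-identityˡ (- y)))
  where
  lem : ∀ x y → x ≡ x ℤ.+ y ℤ.+ - y
  lem = solve-∀

sumTo-+ : ∀ n f g → sumTo n (λ k → f k ℤ.+ g k) ≡ sumTo n f ℤ.+ sumTo n g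
sumTo-+ zero    f g = refl
sumTo-+ (suc n) f g = begin
  sumTo n (λ k → f k ℤ.+ g k) ℤ.+ (f (suc n) ℤ.+ g (suc n))   ≡⟨ cong (ℤ._+ (f (suc n) ℤ.+ g (suc n))) (sumTo-+ n f g) ⟩
  (sumTo n f ℤ.+ sumTo n g) ℤ.+ (f (suc n) ℤ.+ g (suc n))     ≡⟨ +-interchange (sumTo n f) _ _ _ ⟩
  sumTo (suc n) f ℤ.+ sumTo (suc n) g                         ∎

sumTo-* : ∀ n c f → sumTo n (λ k → c ℤ.* f k) ≡ c ℤ.* sumTo n f
sumTo-* zero    c f = refl
sumTo-* (suc n) c f = trans (cong (ℤ._+ (c ℤ.* f (suc n))) (sumTo-* n c f)) (sym (ℤₚ.*-distribˡ-+ c (sumTo n f) (f (suc n))))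

sumTo-0 : ∀ n → sumTo n (λ _ → + 0) ≡ + 0
sumTo-0 zero    = refl
sumTo-0 (suc n) = cong (ℤ._+ + 0) (sumTo-0 n)

sumTo-swap : ∀ m n (f : ℕ → ℕ → ℤ) →
  sumTo m (λ i → sumTo n (f i)) ≡ sumTo n (λ k → sumTo m (λ i → f i k))
sumTo-swap zero    n f = refl
sumTo-swap (suc m) n f =
  trans (cong (ℤ._+ sumTo n (f (suc m))) (sumTo-swap m n f))
        (sym (sumTo-+ n (λ k → sumTo m (λ i → f i k)) (f (suc m))))

-- The product of exponential generating functions in the form `(ab)' = a'b + ab'`, a shift of the
-- sequence being a derivative of its series. The Leibniz rule for insertion produces exactly this
-- recursion.
binConv : (ℕ → ℤ) → (ℕ → ℤ) → ℕ → ℤ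
binConv a b zero    = a 0 ℤ.* b 0
binConv a b (suc n) = binConv (λ k → a (suc k)) b n ℤ.+ binConv a (λ k → b (suc k)) n

binConv-sumTo : ∀ a b n → binConv a b n ≡ sumTo n (λ k → + (n C k) ℤ.* (a k ℤ.* b (n ∸ k)))
binConv-sumTo a b zero    = sym (ℤₚ.*-identityˡ _)
binConv-sumTo a b (suc n) = begin
  binConv (λ k → a (suc k)) b n ℤ.+ binConv a (λ k → b (suc k)) n
    ≡⟨ cong₂ ℤ._+_ (binConv-sumTo (λ k → a (suc k)) b n) (binConv-sumTo a (λ k → b (suc k)) n) ⟩
  S₁ ℤ.+ sumTo n (λ k → + (n C k) ℤ.* (a k ℤ.* b (suc (n ∸ k))))
    ≡⟨ cong (ℤ._+_ S₁) (sumTo-cong n (λ k k≤n → cong (λ i → + (n C k) ℤ.* (a k ℤ.* b i)) (sym (ℕₚ.+-∸-assoc 1 k≤n)))) ⟩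
  S₁ ℤ.+ sumTo n h
    -- The zero term at `suc n` is added so that `k = 0`, which has no partner in Pascal's rule, can
    -- be split off.
    ≡⟨ cong (ℤ._+_ S₁) (sym (trans (cong (ℤ._+_ (sumTo n h)) last≡0) (ℤₚ.+-identityʳ _))) ⟩
  S₁ ℤ.+ sumTo (suc n) h
    ≡⟨ cong (ℤ._+_ S₁) (sumTo-suc n h) ⟩
  S₁ ℤ.+ (h 0 ℤ.+ S₂)
    ≡⟨ swap S₁ (h 0) S₂ ⟩
  h 0 ℤ.+ (S₁ ℤ.+ S₂)
    ≡⟨ cong (ℤ._+_ (h 0)) (sym (sumTo-+ n _ _)) ⟩
  h 0 ℤ.+ sumTo n (λ k → + (n C k) ℤ.* (a (suc k) ℤ.* b (n ∸ k)) ℤ.+ h (suc k))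
    ≡⟨ cong (ℤ._+_ (h 0)) (sumTo-cong n (λ k _ → pascal k)) ⟩
  g 0 ℤ.+ sumTo n (λ k → g (suc k))
    ≡⟨ sym (sumTo-suc n g) ⟩
  sumTo (suc n) g ∎
  where
  g h : ℕ → ℤ
  g k = + (suc n C k) ℤ.* (a k ℤ.* b (suc n ∸ k))
  h k = + (n C k) ℤ.* (a k ℤ.* b (suc n ∸ k))
  S₁ S₂ : ℤ
  S₁ = sumTo n (λ k → + (n C k) ℤ.* (a (suc k) ℤ.* b (n ∸ k)))
  S₂ = sumTo n (λ k → h (suc k))
  last≡0 : h (suc n) ≡ + 0
  last≡0 = cong (λ c → + c ℤ.* (a (suc n) ℤ.* b (suc n ∸ suc n))) (k>n⇒nCk≡0 (ℕₚ.n<1+n n))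
  swap : ∀ x y z → x ℤ.+ (y ℤ.+ z) ≡ y ℤ.+ (x ℤ.+ z)
  swap = solve-∀
  pascal : ∀ k → + (n C k) ℤ.* (a (suc k) ℤ.* b (n ∸ k)) ℤ.+ h (suc k) ≡ g (suc k)
  pascal k = begin
    + (n C k) ℤ.* X ℤ.+ + (n C suc k) ℤ.* X  ≡⟨ ℤₚ.*-distribʳ-+ X (+ (n C k)) (+ (n C suc k)) ⟨
    + (n C k + n C suc k) ℤ.* X              ≡⟨ cong (λ c → + c ℤ.* X) (nCk+nC[k+1]≡[n+1]C[k+1] n k) ⟩
    + (suc n C suc k) ℤ.* X                  ∎
    where
    X : ℤ
    X = a (suc k) ℤ.* b (n ∸ k)

-- Sums over permutations of statistics depending only on relative order

SameRank : ℕ → ℕ → List ℕ → List ℕ → Set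
SameRank x y = Pointwise (λ a b → (x <ᵇ a) ≡ (y <ᵇ b))

-- Only the comparisons of a letter with later ones are recorded.
infix 4 _~_
data _~_ : List ℕ → List ℕ → Set where
  []  : [] ~ []
  _∷_ : ∀ {x y v w} → SameRank x y v w → v ~ w → (x ∷ v) ~ (y ∷ w)

~-refl : ∀ v → v ~ v
~-refl []      = []
~-refl (x ∷ v) = Pointwise.refl refl ∷ ~-refl v

Invariant : (List ℕ → ℤ) → Set
Invariant φ = ∀ {v w} → v ~ w → φ v ≡ φ w

<⇒<ᵇ≡true : ∀ {m n} → m < n → (m <ᵇ n) ≡ true
<⇒<ᵇ≡true {m} {n} m<n with m <ᵇ n | ℕₚ.<⇒<ᵇ m<n
... | true | _ = refl

<ᵇ≡true⇒< : ∀ m n → (m <ᵇ n) ≡ true → m < n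
<ᵇ≡true⇒< m n eq = ℕₚ.<ᵇ⇒< m n (subst T (sym eq) _)

≤⇒<ᵇ≡false : ∀ {m n} → n ≤ m → (m <ᵇ n) ≡ false
≤⇒<ᵇ≡false {m} {n} n≤m with m <ᵇ n in eq
... | false = refl
... | true  = contradiction n≤m (ℕₚ.<⇒≱ (<ᵇ≡true⇒< m n eq))

<ᵇ≡false⇒≥ : ∀ m n → (m <ᵇ n) ≡ false → n ≤ m
<ᵇ≡false⇒≥ m n eq = ℕₚ.≮⇒≥ (λ m<n → contradiction (trans (sym eq) (<⇒<ᵇ≡true m<n)) (λ ()))

sumOver : {X : Set} → (X → ℤ) → List X → ℤ
sumOver φ []       = + 0
sumOver φ (x ∷ xs) = φ x ℤ.+ sumOver φ xs

sumOver-cong : {X : Set} {φ ψ : X → ℤ} (xs : List X) → All (λ x → φ x ≡ ψ x) xs → sumOver φ xs ≡ sumOver ψ xs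
sumOver-cong []       []       = refl
sumOver-cong (x ∷ xs) (e ∷ es) = cong₂ ℤ._+_ e (sumOver-cong xs es)

sumOver-++ : {X : Set} (φ : X → ℤ) (xs ys : List X) → sumOver φ (xs ++ ys) ≡ sumOver φ xs ℤ.+ sumOver φ ys
sumOver-++ φ []       ys = sym (ℤₚ.+-identityˡ _)
sumOver-++ φ (x ∷ xs) ys = trans (cong (ℤ._+_ (φ x)) (sumOver-++ φ xs ys)) (sym (ℤₚ.+-assoc (φ x) _ _))

sumOver-map : {X Y : Set} (φ : Y → ℤ) (f : X → Y) (xs : List X) → sumOver φ (map f xs) ≡ sumOver (λ x → φ (f x)) xs
sumOver-map φ f []       = refl
sumOver-map φ f (x ∷ xs) = cong (ℤ._+_ (φ (f x))) (sumOver-map φ f xs)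

sumOver-concatMap : {X Y : Set} (φ : Y → ℤ) (f : X → List Y) (xs : List X) →
  sumOver φ (concatMap f xs) ≡ sumOver (λ x → sumOver φ (f x)) xs
sumOver-concatMap φ f []       = refl
sumOver-concatMap φ f (x ∷ xs) =
  trans (sumOver-++ φ (f x) (concatMap f xs)) (cong (ℤ._+_ (sumOver φ (f x))) (sumOver-concatMap φ f xs))

sumInsert : ℕ → (List ℕ → ℤ) → List ℕ → ℤ
sumInsert M φ v = sumOver φ (insertions M v)

sumInsert-∷ : ∀ M φ x v → sumInsert M φ (x ∷ v) ≡ φ (M ∷ x ∷ v) ℤ.+ sumInsert M (λ u → φ (x ∷ u)) v
sumInsert-∷ M φ x v = cong (ℤ._+_ (φ (M ∷ x ∷ v))) (sumOver-map φ (x ∷_) (insertions M v))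

private
  insertions-Pointwise : ∀ {R : ℕ → ℕ → Set} {M N v w} → R M N → Pointwise R v w →
    Pointwise (Pointwise R) (insertions M v) (insertions N w)
  insertions-Pointwise r []       = (r ∷ []) ∷ []
  insertions-Pointwise r (s ∷ ss) =
    (r ∷ s ∷ ss) ∷ Pointwise.map⁺ (_ ∷_) (_ ∷_) (Pointwise.map (s ∷_) (insertions-Pointwise r ss))

  insertions-~ : ∀ {M N v w} → All (_< M) v → All (_< N) w → v ~ w →
    Pointwise _~_ (insertions M v) (insertions N w)
  insertions-~ []       []       []       = ([] ∷ []) ∷ []
  insertions-~ {M} {N} {x ∷ v} {y ∷ w} (x<M ∷ v<M) (y<N ∷ w<N) (r ∷ v~w) =
    (top (x<M ∷ v<M) (y<N ∷ w<N) (r ∷ v~w) ∷ (r ∷ v~w))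
    ∷ add (insertions-Pointwise (trans (<⇒<ᵇ≡true x<M) (sym (<⇒<ᵇ≡true y<N))) r) (insertions-~ v<M w<N v~w)
    where
    top : ∀ {v w} → All (_< M) v → All (_< N) w → v ~ w → SameRank M N v w
    top []       []       []      = []
    top (p ∷ ps) (q ∷ qs) (_ ∷ s) =
      trans (≤⇒<ᵇ≡false (ℕₚ.<⇒≤ p)) (sym (≤⇒<ᵇ≡false (ℕₚ.<⇒≤ q))) ∷ top ps qs s
    add : ∀ {vs ws} → Pointwise (SameRank x y) vs ws → Pointwise _~_ vs ws →
      Pointwise _~_ (map (x ∷_) vs) (map (y ∷_) ws)
    add []       []       = []
    add (p ∷ ps) (q ∷ qs) = (p ∷ q) ∷ add ps qs

-- A new maximum compares in the same way with all letters of either word, so the insertions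
-- correspond one by one whatever values are inserted.
sumInsert-~ : ∀ {φ} → Invariant φ → ∀ {M N v w} → All (_< M) v → All (_< N) w → v ~ w →
  sumInsert M φ v ≡ sumInsert N φ w
sumInsert-~ {φ} inv v<M w<N v~w = go (insertions-~ v<M w<N v~w)
  where
  go : ∀ {vs ws} → Pointwise _~_ vs ws → sumOver φ vs ≡ sumOver φ ws
  go []       = refl
  go (p ∷ ps) = cong₂ ℤ._+_ (inv p) (go ps)

-- Any letter exceeding all of v could be inserted; this choice keeps the operator independent of the ambient length.
top : List ℕ → ℕ
top v = suc (sum v)

<top : ∀ v → All (_< top v) v
<top []      = []
<top (x ∷ v) = s≤s (ℕₚ.m≤m+n x (sum v)) ∷ All.map (λ p → ≤-trans p (s≤s (ℕₚ.m≤n+m (sum v) x))) (<top v)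

D : (List ℕ → ℤ) → List ℕ → ℤ
D φ v = sumInsert (top v) φ v

D-invariant : ∀ {φ} → Invariant φ → Invariant (D φ)
D-invariant inv {v} {w} v~w = sumInsert-~ inv (<top v) (<top w) v~w

sumInsert≡D : ∀ {φ} → Invariant φ → ∀ {M v} → All (_< M) v → sumInsert M φ v ≡ D φ v
sumInsert≡D inv {v = v} v<M = sumInsert-~ inv v<M (<top v) (~-refl v)

-- Insertion of the largest letter builds all permutations, so iterating `D` and evaluating at the
-- empty word sums over them; `D` plays the part of a derivative.
total : (List ℕ → ℤ) → ℕ → ℤ
total φ zero    = φ []
total φ (suc n) = total (D φ) n

All-insertions : ∀ {P : ℕ → Set} {x} → P x → ∀ {v} → All P v → All (All P) (insertions x v)
All-insertions px []        = (px ∷ []) ∷ []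
All-insertions px (py ∷ pv) = (px ∷ py ∷ pv) ∷ map⁺ (All.map (py ∷_) (All-insertions px pv))

All-concatMap : ∀ {X Y : Set} {P : X → Set} {Q : Y → Set} {f : X → List Y} → (∀ {x} → P x → All Q (f x)) →
  ∀ {xs} → All P xs → All Q (concatMap f xs)
All-concatMap h []       = []
All-concatMap h (p ∷ ps) = ++⁺ (h p) (All-concatMap h ps)

perms-bounded : ∀ n → All (All (_< suc n)) (perms n)
perms-bounded zero    = [] ∷ []
perms-bounded (suc n) =
  All-concatMap (λ b → All-insertions ≤-refl (All.map ℕₚ.m<n⇒m<1+n b)) (perms-bounded n)

sumOver-perms : ∀ {φ} → Invariant φ → ∀ n → sumOver φ (perms n) ≡ total φ n
sumOver-perms inv zero    = ℤₚ.+-identityʳ _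
sumOver-perms {φ} inv (suc n) = begin
  sumOver φ (concatMap (insertions (suc n)) (perms n))  ≡⟨ sumOver-concatMap φ (insertions (suc n)) (perms n) ⟩
  sumOver (sumInsert (suc n) φ) (perms n)               ≡⟨ sumOver-cong (perms n) (All.map (sumInsert≡D inv) (perms-bounded n)) ⟩
  sumOver (D φ) (perms n)                               ≡⟨ sumOver-perms (D-invariant inv) n ⟩
  total (D φ) n                                         ∎

sumInsert-length-cong : ∀ M {φ ψ} n → (∀ w → length w ≡ suc n → φ w ≡ ψ w) →
  ∀ w → length w ≡ n → sumInsert M φ w ≡ sumInsert M ψ w
sumInsert-length-cong M {φ} {ψ} n φ≈ψ []      refl = cong (ℤ._+ + 0) (φ≈ψ (M ∷ []) refl)
sumInsert-length-cong M {φ} {ψ} n φ≈ψ (x ∷ w) refl = begin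
  sumInsert M φ (x ∷ w)                                    ≡⟨ sumInsert-∷ M φ x w ⟩
  φ (M ∷ x ∷ w) ℤ.+ sumInsert M (λ u → φ (x ∷ u)) w
    ≡⟨ cong₂ ℤ._+_ (φ≈ψ (M ∷ x ∷ w) refl)
         (sumInsert-length-cong M (length w) (λ u eq → φ≈ψ (x ∷ u) (cong suc eq)) w refl) ⟩
  ψ (M ∷ x ∷ w) ℤ.+ sumInsert M (λ u → ψ (x ∷ u)) w        ≡⟨ sumInsert-∷ M ψ x w ⟨
  sumInsert M ψ (x ∷ w)                                    ∎

total-length-cong : ∀ n {φ ψ} → (∀ w → length w ≡ n → φ w ≡ ψ w) → total φ n ≡ total ψ n
total-length-cong zero    φ≈ψ = φ≈ψ [] refl
total-length-cong (suc n) φ≈ψ =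
  total-length-cong n (λ w → sumInsert-length-cong (top w) n φ≈ψ w)

total-cong : ∀ n {φ ψ} → (∀ w → φ w ≡ ψ w) → total φ n ≡ total ψ n
total-cong n φ≈ψ = total-length-cong n (λ w _ → φ≈ψ w)

sumOver-+ : {X : Set} (φ ψ : X → ℤ) (xs : List X) →
  sumOver (λ x → φ x ℤ.+ ψ x) xs ≡ sumOver φ xs ℤ.+ sumOver ψ xs
sumOver-+ φ ψ []       = refl
sumOver-+ φ ψ (x ∷ xs) = trans (cong (ℤ._+_ (φ x ℤ.+ ψ x)) (sumOver-+ φ ψ xs)) (+-interchange (φ x) (ψ x) _ _)

total-+ : ∀ n φ ψ → total (λ w → φ w ℤ.+ ψ w) n ≡ total φ n ℤ.+ total ψ n
total-+ zero    φ ψ = refl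
total-+ (suc n) φ ψ =
  trans (total-cong n (λ w → sumOver-+ φ ψ (insertions (top w) w))) (total-+ n (D φ) (D ψ))

total-0 : ∀ n → total (λ _ → + 0) n ≡ + 0
total-0 zero    = refl
total-0 (suc n) = trans (total-cong n (λ w → sumOver-0 (insertions (top w) w))) (total-0 n)
  where
  sumOver-0 : ∀ (xs : List (List ℕ)) → sumOver (λ _ → + 0) xs ≡ + 0
  sumOver-0 []       = refl
  sumOver-0 (x ∷ xs) = cong (ℤ._+_ (+ 0)) (sumOver-0 xs)

total-neg : ∀ n φ → total (λ w → - φ w) n ≡ - total φ n
total-neg n φ = +≡0⇒≡- (trans (sym (total-+ n (λ w → - φ w) φ))
  (trans (total-cong n (λ w → ℤₚ.+-inverseˡ (φ w))) (total-0 n)))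

total-sumTo : ∀ n j (φ : ℕ → List ℕ → ℤ) → total (λ w → sumTo j (λ i → φ i w)) n ≡ sumTo j (λ i → total (φ i) n)
total-sumTo n zero    φ = refl
total-sumTo n (suc j) φ =
  trans (total-+ n (λ w → sumTo j (λ i → φ i w)) (φ (suc j))) (cong (ℤ._+ total (φ (suc j)) n) (total-sumTo n j φ))

-- Convolution of word statistics

conv : (List ℕ → ℤ) → (List ℕ → ℤ) → List ℕ → ℤ
conv P Q []      = P [] ℤ.* Q []
conv P Q (x ∷ w) = P [] ℤ.* Q (x ∷ w) ℤ.+ conv (λ u → P (x ∷ u)) Q w

-- `S` is a condition on single letters, hence inherited by both factors. It serves for boundedness
-- by the inserted letter, under which `sumInsert M` and `D` agree.
conv-cong : ∀ {S : ℕ → Set} {P P′ Q Q′} → (∀ u → All S u → P u ≡ P′ u) → (∀ u → All S u → Q u ≡ Q′ u) →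
  ∀ w → All S w → conv P Q w ≡ conv P′ Q′ w
conv-cong p q []      []       = cong₂ ℤ._*_ (p [] []) (q [] [])
conv-cong p q (x ∷ w) (s ∷ ss) =
  cong₂ ℤ._+_ (cong₂ ℤ._*_ (p [] []) (q (x ∷ w) (s ∷ ss))) (conv-cong (λ u us → p (x ∷ u) (s ∷ us)) q w ss)

conv-+ˡ : ∀ P P′ Q w → conv (λ u → P u ℤ.+ P′ u) Q w ≡ conv P Q w ℤ.+ conv P′ Q w
conv-+ˡ P P′ Q []      = ℤₚ.*-distribʳ-+ (Q []) (P []) (P′ [])
conv-+ˡ P P′ Q (x ∷ w) =
  trans (cong₂ ℤ._+_ (ℤₚ.*-distribʳ-+ (Q (x ∷ w)) (P []) (P′ []))
                     (conv-+ˡ (λ u → P (x ∷ u)) (λ u → P′ (x ∷ u)) Q w))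
        (+-interchange (P [] ℤ.* Q (x ∷ w)) _ _ _)

conv-0 : ∀ Q w → conv (λ _ → + 0) Q w ≡ + 0
conv-0 Q []      = refl
conv-0 Q (x ∷ w) = cong (ℤ._+_ (+ 0)) (conv-0 Q w)

-- Leibniz rule: the inserted letter lands in one of the two factors.
sumInsert-conv : ∀ M P Q w → sumInsert M (conv P Q) w ≡ conv (sumInsert M P) Q w ℤ.+ conv P (sumInsert M Q) w
sumInsert-conv M P Q []      = solved (P []) (P (M ∷ [])) (Q []) (Q (M ∷ []))
  where
  solved : ∀ p p′ q q′ → p ℤ.* q′ ℤ.+ p′ ℤ.* q ℤ.+ + 0 ≡ (p′ ℤ.+ + 0) ℤ.* q ℤ.+ p ℤ.* (q′ ℤ.+ + 0)
  solved = solve-∀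
sumInsert-conv M P Q (x ∷ w) = begin
  sumInsert M (conv P Q) (x ∷ w)
    ≡⟨ sumInsert-∷ M (conv P Q) x w ⟩
  conv P Q (M ∷ x ∷ w) ℤ.+ sumInsert M (λ u → P [] ℤ.* Q (x ∷ u) ℤ.+ conv Pₓ Q u) w
    ≡⟨ cong (ℤ._+_ (conv P Q (M ∷ x ∷ w))) (trans (sumOver-+ (λ u → P [] ℤ.* Q (x ∷ u)) (conv Pₓ Q) (insertions M w))
         (cong₂ ℤ._+_ (scaleSum (insertions M w)) (sumInsert-conv M Pₓ Q w))) ⟩
  (P [] ℤ.* Q (M ∷ x ∷ w) ℤ.+ (P (M ∷ []) ℤ.* Q (x ∷ w) ℤ.+ conv (λ u → P (M ∷ x ∷ u)) Q w))
    ℤ.+ (P [] ℤ.* sumInsert M Qₓ w ℤ.+ (conv (sumInsert M Pₓ) Q w ℤ.+ conv Pₓ (sumInsert M Q) w))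
    ≡⟨ rearrange (P []) (Q (M ∷ x ∷ w)) (P (M ∷ [])) (Q (x ∷ w)) _ (sumInsert M Qₓ w) _ _ ⟩
  ((P (M ∷ []) ℤ.+ + 0) ℤ.* Q (x ∷ w) ℤ.+ (conv (λ u → P (M ∷ x ∷ u)) Q w ℤ.+ conv (sumInsert M Pₓ) Q w))
    ℤ.+ (P [] ℤ.* (Q (M ∷ x ∷ w) ℤ.+ sumInsert M Qₓ w) ℤ.+ conv Pₓ (sumInsert M Q) w)
    ≡⟨ cong₂ (λ a b → ((P (M ∷ []) ℤ.+ + 0) ℤ.* Q (x ∷ w) ℤ.+ a) ℤ.+ (P [] ℤ.* b ℤ.+ conv Pₓ (sumInsert M Q) w))
         (trans (sym (conv-+ˡ (λ u → P (M ∷ x ∷ u)) (sumInsert M Pₓ) Q w))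
                (conv-cong (λ u _ → sym (sumInsert-∷ M P x u)) (λ _ _ → refl) w (trivial w)))
         (sym (sumInsert-∷ M Q x w)) ⟩
  conv (sumInsert M P) Q (x ∷ w) ℤ.+ conv P (sumInsert M Q) (x ∷ w) ∎
  where
  Pₓ Qₓ : List ℕ → ℤ
  Pₓ u = P (x ∷ u)
  Qₓ u = Q (x ∷ u)
  scaleSum : ∀ vs → sumOver (λ u → P [] ℤ.* Q (x ∷ u)) vs ≡ P [] ℤ.* sumOver Qₓ vs
  scaleSum []       = sym (ℤₚ.*-zeroʳ (P []))
  scaleSum (v ∷ vs) = trans (cong (ℤ._+_ (P [] ℤ.* Qₓ v)) (scaleSum vs)) (sym (ℤₚ.*-distribˡ-+ (P []) (Qₓ v) (sumOver Qₓ vs)))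
  trivial : ∀ u → All (λ _ → T true) u
  trivial []      = []
  trivial (_ ∷ u) = _ ∷ trivial u
  rearrange : ∀ p q p′ q′ a r b c → (p ℤ.* q ℤ.+ (p′ ℤ.* q′ ℤ.+ a)) ℤ.+ (p ℤ.* r ℤ.+ (b ℤ.+ c))
    ≡ ((p′ ℤ.+ + 0) ℤ.* q′ ℤ.+ (a ℤ.+ b)) ℤ.+ (p ℤ.* (q ℤ.+ r) ℤ.+ c)
  rearrange = solve-∀

total-conv : ∀ n {P Q} → Invariant P → Invariant Q → total (conv P Q) n ≡ binConv (total P) (total Q) n
total-conv zero    invP invQ = refl
total-conv (suc n) {P} {Q} invP invQ = begin
  total (D (conv P Q)) n
    ≡⟨ total-cong n (λ w → trans (sumInsert-conv (top w) P Q w) (cong₂ ℤ._+_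
         (conv-cong (λ _ → sumInsert≡D invP) (λ _ _ → refl) w (<top w))
         (conv-cong (λ _ _ → refl) (λ _ → sumInsert≡D invQ) w (<top w)))) ⟩
  total (λ w → conv (D P) Q w ℤ.+ conv P (D Q) w) n
    ≡⟨ total-+ n (conv (D P) Q) (conv P (D Q)) ⟩
  total (conv (D P) Q) n ℤ.+ total (conv P (D Q)) n
    ≡⟨ cong₂ ℤ._+_ (total-conv n (D-invariant invP) invQ) (total-conv n invP (D-invariant invQ)) ⟩
  binConv (total P) (total Q) (suc n) ∎

-- Splitting off the first letter

dropFirst : (List ℕ → ℤ) → List ℕ → ℤ
dropFirst φ []      = + 0
dropFirst φ (x ∷ w) = φ w

dropFirst-invariant : ∀ {φ} → Invariant φ → Invariant (dropFirst φ)
dropFirst-invariant inv []        = refl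
dropFirst-invariant inv (_ ∷ v~w) = inv v~w

-- Deleting the first letter leaves each relative order `suc n` times, once for every value of that
-- letter. The induction separates insertion of the largest letter in front from insertion further
-- on.
total-dropFirst : ∀ n {φ} → Invariant φ → total (dropFirst φ) (suc n) ≡ + suc n ℤ.* total φ n
total-dropFirst zero    {φ} inv = trans (ℤₚ.+-identityʳ (φ [])) (sym (ℤₚ.*-identityˡ (φ [])))
total-dropFirst (suc n) {φ} inv = begin
  total (D (dropFirst φ)) (suc n)
    ≡⟨ total-length-cong (suc n) derive ⟩
  total (λ w → φ w ℤ.+ dropFirst (D φ) w) (suc n)
    ≡⟨ total-+ (suc n) φ (dropFirst (D φ)) ⟩
  total φ (suc n) ℤ.+ total (dropFirst (D φ)) (suc n)
    ≡⟨ cong (ℤ._+_ (total φ (suc n))) (total-dropFirst n (D-invariant inv)) ⟩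
  total φ (suc n) ℤ.+ + suc n ℤ.* total φ (suc n)
    ≡⟨ ℤₚ.suc-* (+ suc n) (total φ (suc n)) ⟨
  + suc (suc n) ℤ.* total φ (suc n) ∎
  where
  derive : ∀ w → length w ≡ suc n → D (dropFirst φ) w ≡ φ w ℤ.+ dropFirst (D φ) w
  derive (x ∷ w) _ with <top (x ∷ w)
  ... | _ ∷ w<M = trans (sumInsert-∷ (top (x ∷ w)) (dropFirst φ) x w) (cong (ℤ._+_ (φ (x ∷ w))) (sumInsert≡D inv w<M))

below : ℕ → List ℕ → Bool
below x []      = true
below x (y ∷ w) = (x <ᵇ y) ∧ below x w

minFirst : (List ℕ → ℤ) → List ℕ → ℤ
minFirst φ []      = + 0
minFirst φ (x ∷ w) = if below x w then φ w else + 0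

below-SameRank : ∀ {x y v w} → SameRank x y v w → below x v ≡ below y w
below-SameRank []       = refl
below-SameRank (r ∷ rs) = cong₂ _∧_ r (below-SameRank rs)

minFirst-invariant : ∀ {φ} → Invariant φ → Invariant (minFirst φ)
minFirst-invariant inv []        = refl
minFirst-invariant inv (r ∷ v~w) = cong₂ (λ b z → if b then z else + 0) (below-SameRank r) (inv v~w)

-- A minimal first letter has one possible value. An inserted maximum cannot precede it, and behind
-- it leaves its minimality unchanged.
total-minFirst : ∀ n {φ} → Invariant φ → total (minFirst φ) (suc n) ≡ total φ n
total-minFirst zero    {φ} inv = ℤₚ.+-identityʳ (φ [])
total-minFirst (suc n) {φ} inv =
  trans (total-length-cong (suc n) derive) (total-minFirst n (D-invariant inv))
  where
  insert : ∀ {M x} → x < M → ∀ w → All (λ u → below x u ≡ below x w) (insertions M w)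
  insert x<M []      = cong (_∧ true) (<⇒<ᵇ≡true x<M) ∷ []
  insert {M} {x} x<M (y ∷ w) = cong (_∧ below x (y ∷ w)) (<⇒<ᵇ≡true x<M) ∷ map⁺ (All.map (cong ((x <ᵇ y) ∧_)) (insert x<M w))
  pull : ∀ b us → sumOver (λ u → if b then φ u else + 0) us ≡ (if b then sumOver φ us else + 0)
  pull true  us       = refl
  pull false []       = refl
  pull false (u ∷ us) = cong (ℤ._+_ (+ 0)) (pull false us)
  derive : ∀ w → length w ≡ suc n → D (minFirst φ) w ≡ minFirst (D φ) w
  derive (x ∷ w) _ with <top (x ∷ w)
  ... | x<M ∷ w<M = begin
    sumInsert M (minFirst φ) (x ∷ w)
      ≡⟨ sumInsert-∷ M (minFirst φ) x w ⟩
    minFirst φ (M ∷ x ∷ w) ℤ.+ sumOver (λ u → if below x u then φ u else + 0) (insertions M w)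
      ≡⟨ cong₂ ℤ._+_ (cong (λ b → if b ∧ below M w then φ (x ∷ w) else + 0) (≤⇒<ᵇ≡false (ℕₚ.<⇒≤ x<M)))
           (sumOver-cong (insertions M w) (All.map (λ {u} eq → cong (λ b → if b then φ u else + 0) eq) (insert x<M w))) ⟩
    + 0 ℤ.+ sumOver (λ u → if below x w then φ u else + 0) (insertions M w)
      ≡⟨ ℤₚ.+-identityˡ _ ⟩
    sumOver (λ u → if below x w then φ u else + 0) (insertions M w)
      ≡⟨ pull (below x w) (insertions M w) ⟩
    (if below x w then sumInsert M φ w else + 0)
      ≡⟨ cong (λ z → if below x w then z else + 0) (sumInsert≡D inv w<M) ⟩
    minFirst (D φ) (x ∷ w) ∎
    where
    M : ℕ
    M = top (x ∷ w)

-- Runs and bricks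

infix 4 _≐_
_≐_ : Poly → Poly → Set
p ≐ q = ∀ j → p j ≡ q j

shift : Poly → Poly
shift p zero    = + 0
shift p (suc j) = p j

shift-cong : ∀ {p q} → p ≐ q → shift p ≐ shift q
shift-cong p≐q zero    = refl
shift-cong p≐q (suc j) = p≐q j

shift-⊛ : ∀ p q → shift p ⊛ q ≐ shift (p ⊛ q)
shift-⊛ p q zero    = refl
shift-⊛ p q (suc j) = trans (sumTo-suc j _) (ℤₚ.+-identityˡ _)

oneP-⊛ : ∀ q → oneP ⊛ q ≐ q
oneP-⊛ q zero    = ℤₚ.*-identityˡ (q 0)
oneP-⊛ q (suc j) = begin
  (oneP ⊛ q) (suc j)                           ≡⟨ sumTo-suc j _ ⟩
  + 1 ℤ.* q (suc j) ℤ.+ sumTo j (λ _ → + 0)    ≡⟨ cong₂ ℤ._+_ (ℤₚ.*-identityˡ (q (suc j))) (sumTo-0 j) ⟩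
  q (suc j) ℤ.+ + 0                            ≡⟨ ℤₚ.+-identityʳ (q (suc j)) ⟩
  q (suc j)                                    ∎

y⊛ : ∀ q → shift oneP ⊛ q ≐ shift q
y⊛ q j = trans (shift-⊛ oneP q j) (shift-cong (oneP-⊛ q) j)

convP : (List ℕ → Poly) → (List ℕ → Poly) → List ℕ → Poly
convP P Q w j = sumTo j (λ i → conv (λ u → P u i) (λ v → Q v (j ∸ i)) w)

convP-∷ : ∀ P Q x w → convP P Q (x ∷ w) ≐ (P [] ⊛ Q (x ∷ w)) ⊕ convP (λ u → P (x ∷ u)) Q w
convP-∷ P Q x w j = sumTo-+ j _ _

convP-0 : ∀ Q w → convP (λ _ → zeroP) Q w ≐ zeroP
convP-0 Q w j = trans (sumTo-cong j (λ i _ → conv-0 (λ v → Q v (j ∸ i)) w)) (sumTo-0 j)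

convP-shift : ∀ P Q w → convP (λ u → shift (P u)) Q w ≐ shift (convP P Q w)
convP-shift P Q w zero    = conv-0 (λ v → Q v 0) w
convP-shift P Q w (suc j) = begin
  convP (λ u → shift (P u)) Q w (suc j)               ≡⟨ sumTo-suc j _ ⟩
  conv (λ _ → + 0) (λ v → Q v (suc j)) w ℤ.+ convP P Q w j
                                                      ≡⟨ cong (ℤ._+ convP P Q w j) (conv-0 (λ v → Q v (suc j)) w) ⟩
  + 0 ℤ.+ convP P Q w j                               ≡⟨ ℤₚ.+-identityˡ _ ⟩
  convP P Q w j                                       ∎

atSuc : ℕ → (ℕ → Poly) → Poly
atSuc zero    f = zeroP
atSuc (suc d) f = f d

-- For distinct letters, 1324 and 1423 together say of `p b x y` that `p < x < b` and `x < y`: they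
-- differ only in the comparison of `b` with `y`. A letter larger than `b` in the place of `p`
-- cannot start such a match, so `nothing` may stand for it.
rebound : Maybe ℕ → ℕ → List ℕ → Bool
rebound (just p) x (y ∷ _) = (p <ᵇ x) ∧ (x <ᵇ y)
rebound _        _ _       = false

belowMaybe : Maybe ℕ → ℕ → Bool
belowMaybe (just p) x = p <ᵇ x
belowMaybe nothing  x = false

-- The parameter is e = s - 2.
module Bricks (e : ℕ) where

  -- The current run ends in b, is preceded there by p if it has at least two letters, and can take d more letters;
  -- runs p d b v is y^(number of remaining runs, the current one included) if v continues the word without a match.
  runs : Maybe ℕ → ℕ → ℕ → List ℕ → Poly
  runs p d b []      = shift oneP
  runs p d b (x ∷ v) =
    if b <ᵇ x then atSuc d (λ d′ → runs (just b) d′ x v)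
    else (if rebound p x v then zeroP else shift (runs nothing (suc e) x v))

  -- The same state for bricks, each weighted by -y; the flag forbids closing the current one-letter brick,
  -- as is required after a descent, where the next brick must supply the last two letters of the match.
  bricks : Bool → Maybe ℕ → ℕ → ℕ → List ℕ → Poly
  bricks m p d b []      = if m then zeroP else neg (shift oneP)
  bricks m p d b (x ∷ v) =
    if b <ᵇ x
    then atSuc d (λ d′ → bricks false (just b) d′ x v)
         ⊕ (if m then zeroP else neg (shift (bricks false nothing (suc e) x v)))
    else (if not m ∧ belowMaybe p x then neg (shift (bricks true nothing (suc e) x v)) else zeroP)

  F : List ℕ → Poly
  F []      = oneP
  F (x ∷ v) = runs nothing (suc e) x v

  G : List ℕ → Poly
  G []      = oneP
  G (x ∷ v) = bricks false nothing (suc e) x v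

  private
    collapse : ∀ {a b c b′ : ℤ} → a ≡ b ℤ.+ c → b ≡ b′ → ∀ {c′} → c ≡ c′ → a ≡ b′ ℤ.+ c′
    collapse p q r = trans p (cong₂ ℤ._+_ q r)

    cancel : ∀ q → shift q ⊕ shift (neg q) ≐ zeroP
    cancel q zero    = refl
    cancel q (suc j) = ℤₚ.+-inverseʳ (q j)

  -- At a descent that creates no match, cutting and not cutting cancel.
  runs-bricks : ∀ p d b v → convP (runs p d b) G v ≐ neg (bricks false p d b v)
  unlinked : ∀ x v → shift (G (x ∷ v)) ⊕ convP (λ u → shift (runs nothing (suc e) x u)) G v ≐ zeroP
  descent : ∀ p x v →
    shift (G (x ∷ v)) ⊕ convP (λ u → if rebound p x u then zeroP else shift (runs nothing (suc e) x u)) G v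
    ≐ neg (if belowMaybe p x then neg (shift (bricks true nothing (suc e) x v)) else zeroP)

  runs-bricks p d b [] j = trans (y⊛ oneP j) (sym (ℤₚ.neg-involutive (shift oneP j)))
  runs-bricks p d b (x ∷ v) j
    with convP-∷ (runs p d b) G x v j | y⊛ (G (x ∷ v)) j
  ... | step | head with b <ᵇ x
  -- A full run cannot absorb `x`, so only the cut before `x` survives.
  runs-bricks p zero b (x ∷ v) j | step | head | true =
    trans (collapse step head (convP-0 G v j)) (lem (shift (G (x ∷ v)) j))
    where
    lem : ∀ g → g ℤ.+ + 0 ≡ - (+ 0 ℤ.+ - g)
    lem = solve-∀
  runs-bricks p (suc d) b (x ∷ v) j | step | head | true =
    trans (collapse step head (runs-bricks (just b) d x v j))
          (lem (shift (G (x ∷ v)) j) (bricks false (just b) d x v j))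
    where
    lem : ∀ g h → g ℤ.+ - h ≡ - (h ℤ.+ - g)
    lem = solve-∀
  runs-bricks p d b (x ∷ v) j | step | head | false = trans (collapse step head refl) (descent p x v j)

  unlinked x v j = begin
    shift (G (x ∷ v)) j ℤ.+ convP (λ u → shift (runs nothing (suc e) x u)) G v j
      ≡⟨ cong (ℤ._+_ (shift (G (x ∷ v)) j)) (trans (convP-shift (runs nothing (suc e) x) G v j)
           (shift-cong (runs-bricks nothing (suc e) x v) j)) ⟩
    shift (G (x ∷ v)) j ℤ.+ shift (neg (G (x ∷ v))) j
      ≡⟨ cancel (G (x ∷ v)) j ⟩
    + 0 ∎

  descent nothing  x v  j = unlinked x v j
  descent (just p) x [] j = trans (unlinked x [] j) (noBrick (p <ᵇ x) j)
    where
    noBrick : ∀ c j → + 0 ≡ neg (if c then neg (shift zeroP) else zeroP) j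
    noBrick false _       = refl
    noBrick true  zero    = refl
    noBrick true  (suc _) = refl
  descent (just p) x (y ∷ v) j
    with convP-∷ (λ u → if rebound (just p) x u then zeroP else shift (runs nothing (suc e) x u)) G y v j
       | trans (cong (ℤ._+_ (shift (G (x ∷ y ∷ v)) j)) (sym (convP-∷ (λ u → shift (runs nothing (suc e) x u)) G y v j)))
               (unlinked x (y ∷ v) j)
  ... | step | un with p <ᵇ x
  ... | false = trans (cong (ℤ._+_ (shift (G (x ∷ y ∷ v)) j)) step) un
  ... | true with x <ᵇ y
  ... | false = trans (trans (cong (ℤ._+_ (shift zeroP j)) step) un) (noBrick j)
    where
    noBrick : ∀ j → + 0 ≡ neg (neg (shift zeroP)) j
    noBrick zero    = refl
    noBrick (suc _) = refl
  -- Now `rebound` holds for every prefix reaching `y`, so the convolution keeps only the cut right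
  -- after `x`. That term cancels the brick consisting of `x` alone, which leaves the bricks
  -- continuing from `x` to `y`, as the flag demands.
  ... | true = trans (cong (ℤ._+_ (shift (H ⊕ neg (shift (G (y ∷ v)))) j))
                       (collapse step (trans (shift-⊛ (shift oneP) (G (y ∷ v)) j) (shift-cong (y⊛ (G (y ∷ v))) j))
                                      (convP-0 G v j)))
                     (solved j)
    where
    H : Poly
    H = bricks false (just x) e y v
    solved : shift (H ⊕ neg (shift (G (y ∷ v)))) ⊕ (shift (shift (G (y ∷ v))) ⊕ zeroP) ≐ neg (neg (shift (H ⊕ zeroP)))
    solved zero    = refl
    solved (suc j) = lem (H j) (shift (G (y ∷ v)) j)
      where
      lem : ∀ h g → (h ℤ.+ - g) ℤ.+ (g ℤ.+ + 0) ≡ - (- (h ℤ.+ + 0))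
      lem = solve-∀

  -- The empty prefix contributes `G` itself, and by `runs-bricks` the other prefixes contribute its
  -- negative.
  F-G-inverse : ∀ x v → convP F G (x ∷ v) ≐ zeroP
  F-G-inverse x v j = trans
    (collapse (convP-∷ F G x v j) (oneP-⊛ (G (x ∷ v)) j) (runs-bricks nothing (suc e) x v j))
    (ℤₚ.+-inverseʳ (G (x ∷ v) j))

  private
    data SameRank? : Maybe ℕ → Maybe ℕ → List ℕ → List ℕ → Set where
      nothing : ∀ {v w} → SameRank? nothing nothing v w
      just    : ∀ {p q v w} → SameRank p q v w → SameRank? (just p) (just q) v w

    belowMaybe-cong : ∀ {p q x y v w} → SameRank? p q (x ∷ v) (y ∷ w) → belowMaybe p x ≡ belowMaybe q y
    belowMaybe-cong nothing        = refl
    belowMaybe-cong (just (r ∷ _)) = r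

    rebound-cong : ∀ {p q x y v w} → SameRank? p q (x ∷ v) (y ∷ w) → SameRank x y v w → rebound p x v ≡ rebound q y w
    rebound-cong nothing         _        = refl
    rebound-cong (just (r ∷ _))  []       = refl
    rebound-cong (just (r ∷ _))  (s ∷ _)  = cong₂ _∧_ r s

    if-cong : ∀ {c c′ : Bool} {p p′ q q′ : Poly} → c ≡ c′ → p ≐ p′ → q ≐ q′ →
      (if c then p else q) ≐ (if c′ then p′ else q′)
    if-cong {true}  refl p≐ q≐ = p≐
    if-cong {false} refl p≐ q≐ = q≐

    neg-cong : ∀ {p q} → p ≐ q → neg p ≐ neg q
    neg-cong p≐q j = cong -_ (p≐q j)

    atSuc-cong : ∀ d {f g} → (∀ d′ → f d′ ≐ g d′) → atSuc d f ≐ atSuc d g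
    atSuc-cong zero    f≐g j = refl
    atSuc-cong (suc d) f≐g   = f≐g d

    runs-cong : ∀ {p q b c v w} d → SameRank? p q v w → SameRank b c v w → v ~ w → runs p d b v ≐ runs q d c w
    runs-cong d ps bs []         = λ _ → refl
    runs-cong d ps (b ∷ bs) (r ∷ v~w) =
      if-cong b (atSuc-cong d (λ d′ → runs-cong d′ (just bs) r v~w))
        (if-cong (rebound-cong ps r) (λ _ → refl) (shift-cong (runs-cong (suc e) nothing r v~w)))

    bricks-cong : ∀ m {p q b c v w} d → SameRank? p q v w → SameRank b c v w → v ~ w →
      bricks m p d b v ≐ bricks m q d c w
    bricks-cong m d ps bs []         = λ _ → refl
    bricks-cong m d ps (b ∷ bs) (r ∷ v~w) =
      if-cong b
        (λ j → cong₂ ℤ._+_ (atSuc-cong d (λ d′ → bricks-cong false d′ (just bs) r v~w) j)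
                 (if-cong {m} refl (λ _ → refl) (neg-cong (shift-cong (bricks-cong false (suc e) nothing r v~w))) j))
        (if-cong (cong (not m ∧_) (belowMaybe-cong ps))
          (neg-cong (shift-cong (bricks-cong true (suc e) nothing r v~w))) (λ _ → refl))

  F-invariant : ∀ j → Invariant (λ w → F w j)
  F-invariant j []        = refl
  F-invariant j (r ∷ v~w) = runs-cong (suc e) nothing r v~w j

  G-invariant : ∀ j → Invariant (λ w → G w j)
  G-invariant j []        = refl
  G-invariant j (r ∷ v~w) = bricks-cong false (suc e) nothing r v~w j

  totalF totalG : ℕ → Poly
  totalF n j = total (λ w → F w j) n
  totalG n j = total (λ w → G w j) n

  total-convP : ∀ n j → total (λ w → convP F G w j) n ≡ sumTo n (λ k → scale (n C k) (totalF k ⊛ totalG (n ∸ k)) j)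
  total-convP n j = begin
    total (λ w → convP F G w j) n
      ≡⟨ total-sumTo n j (λ i → conv (λ u → F u i) (λ v → G v (j ∸ i))) ⟩
    sumTo j (λ i → total (conv (λ u → F u i) (λ v → G v (j ∸ i))) n)
      ≡⟨ sumTo-cong j (λ i _ → trans (total-conv n (F-invariant i) (G-invariant (j ∸ i)))
           (binConv-sumTo (λ k → totalF k i) (λ k → totalG k (j ∸ i)) n)) ⟩
    sumTo j (λ i → sumTo n (λ k → + (n C k) ℤ.* (totalF k i ℤ.* totalG (n ∸ k) (j ∸ i))))
      ≡⟨ sumTo-swap j n _ ⟩
    sumTo n (λ k → sumTo j (λ i → + (n C k) ℤ.* (totalF k i ℤ.* totalG (n ∸ k) (j ∸ i))))
      ≡⟨ sumTo-cong n (λ k _ → sumTo-* j (+ (n C k)) (λ i → totalF k i ℤ.* totalG (n ∸ k) (j ∸ i))) ⟩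
    sumTo n (λ k → scale (n C k) (totalF k ⊛ totalG (n ∸ k)) j) ∎

  -- The term `k = 0` of the vanishing total of `convP F G` is `totalG (suc m)`, since `F []` is 1.
  -- Solving for it gives the recursion defining `U`, with `totalF` in place of `A`.
  totalG-suc : ∀ m → totalG (suc m) ≐ neg (λ j → sumTo m (λ k → scale (suc m C suc k) (totalF (suc k) ⊛ totalG (m ∸ k)) j))
  totalG-suc m j = +≡0⇒≡- (begin
    totalG (suc m) j ℤ.+ sumTo m (λ k → g (suc k))
      ≡⟨ cong (ℤ._+ sumTo m (λ k → g (suc k))) (sym (trans (ℤₚ.*-identityˡ _) (oneP-⊛ (totalG (suc m)) j))) ⟩
    g 0 ℤ.+ sumTo m (λ k → g (suc k))
      ≡⟨ sumTo-suc m g ⟨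
    sumTo (suc m) g
      ≡⟨ total-convP (suc m) j ⟨
    total (λ w → convP F G w j) (suc m)
      ≡⟨ total-length-cong (suc m) vanish ⟩
    total (λ _ → + 0) (suc m)
      ≡⟨ total-0 (suc m) ⟩
    + 0 ∎)
    where
    g : ℕ → ℤ
    g k = scale (suc m C k) (totalF k ⊛ totalG (suc m ∸ k)) j
    vanish : ∀ w → length w ≡ suc m → convP F G w j ≡ + 0
    vanish (x ∷ v) _ = F-G-inverse x v j

-- Identification of `U` with the totals of `G`

-- The recursion step of U is a private function, so it is recovered by unification from the unfolding of U.
mutual
  step : List (List ℕ) → ℕ → ℕ → List Poly → Poly
  step = _

  U-suc : ∀ Γ m → U Γ (suc m) ≡ neg (step Γ m 1 (history Γ m))
  U-suc Γ m with 1 | history Γ m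
  ... | k | us = cong neg (refl {x = step Γ m k us})

downFrom : (ℕ → Poly) → ℕ → List Poly
downFrom u zero    = u 0 ∷ []
downFrom u (suc n) = u (suc n) ∷ downFrom u n

⊛-cong : ∀ {p p′ q q′} → p ≐ p′ → q ≐ q′ → p ⊛ q ≐ p′ ⊛ q′
⊛-cong p≐ q≐ j = sumTo-cong j (λ i _ → cong₂ ℤ._*_ (p≐ i) (q≐ (j ∸ i)))

step-downFrom : ∀ Γ {a u : ℕ → Poly} → (∀ k → A Γ (suc k) ≐ a (suc k)) → ∀ m k n us → Pointwise _≐_ us (downFrom u n) →
  step Γ m (suc k) us ≐ λ j → sumTo n (λ i → scale (suc m C (suc k + i)) (a (suc k + i) ⊛ u (n ∸ i)) j)
step-downFrom Γ {a} {u} A≐a m k zero (v ∷ []) (v≐ ∷ []) j = begin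
  scale (suc m C suc k) (A Γ (suc k) ⊛ v) j ℤ.+ + 0     ≡⟨ ℤₚ.+-identityʳ _ ⟩
  scale (suc m C suc k) (A Γ (suc k) ⊛ v) j             ≡⟨ cong (ℤ._*_ (+ (suc m C suc k))) (⊛-cong (A≐a k) v≐ j) ⟩
  scale (suc m C suc k) (a (suc k) ⊛ u 0) j             ≡⟨ cong (λ i → scale (suc m C i) (a i ⊛ u 0) j) (sym (ℕₚ.+-identityʳ (suc k))) ⟩
  scale (suc m C (suc k + 0)) (a (suc k + 0) ⊛ u 0) j   ∎
step-downFrom Γ {a} {u} A≐a m k (suc n) (v ∷ us) (v≐ ∷ us≐) j = begin
  scale (suc m C suc k) (A Γ (suc k) ⊛ v) j ℤ.+ step Γ m (2 + k) us j
    ≡⟨ cong₂ ℤ._+_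
         (trans (cong (ℤ._*_ (+ (suc m C suc k))) (⊛-cong (A≐a k) v≐ j))
                (cong (λ i → scale (suc m C i) (a i ⊛ u (suc n)) j) (sym (ℕₚ.+-identityʳ (suc k)))))
         (trans (step-downFrom Γ {a} {u} A≐a m (suc k) n us us≐ j)
                (sumTo-cong n (λ i _ → cong (λ l → scale (suc m C l) (a l ⊛ u (n ∸ i)) j) (sym (ℕₚ.+-suc (suc k) i))))) ⟩
  g 0 ℤ.+ sumTo n (λ i → g (suc i))
    ≡⟨ sumTo-suc n g ⟨
  sumTo (suc n) g ∎
  where
  g : ℕ → ℤ
  g i = scale (suc m C (suc k + i)) (a (suc k + i) ⊛ u (suc n ∸ i)) j

module _ (e : ℕ) (Γ : List (List ℕ)) (A≐F : ∀ k → A Γ (suc k) ≐ Bricks.totalF e (suc k)) where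
  open Bricks e

  private
    U-suc≐ : ∀ m → Pointwise _≐_ (history Γ m) (downFrom totalG m) → U Γ (suc m) ≐ totalG (suc m)
    U-suc≐ m hist j = begin
      U Γ (suc m) j                               ≡⟨ cong (λ p → p j) (U-suc Γ m) ⟩
      - step Γ m 1 (history Γ m) j                ≡⟨ cong -_ (step-downFrom Γ {totalF} A≐F m 0 m (history Γ m) hist j) ⟩
      - sumTo m (λ k → scale (suc m C suc k) (totalF (suc k) ⊛ totalG (m ∸ k)) j)
                                                  ≡⟨ totalG-suc m j ⟨
      totalG (suc m) j                            ∎

    history≐ : ∀ n → Pointwise _≐_ (history Γ n) (downFrom totalG n)
    history≐ zero    = (λ _ → refl) ∷ []
    history≐ (suc n) = U-suc≐ n (history≐ n) ∷ history≐ n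

  U≐totalG : ∀ n → U Γ n ≐ totalG n
  U≐totalG zero    = λ _ → refl
  U≐totalG (suc n) = U-suc≐ n (history≐ n)

-- Pattern matches

rank : List ℕ → ℕ → ℕ
rank α x = suc (countᵇ (_<ᵇ x) α)

countᵇ-∷ : ∀ p a α → countᵇ p (a ∷ α) ≡ (if p a then 1 else 0) + countᵇ p α
countᵇ-∷ p a α with p a
... | true  = refl
... | false = refl

countᵇ-mono : ∀ α {x y} → x ≤ y → countᵇ (_<ᵇ x) α ≤ countᵇ (_<ᵇ y) α
countᵇ-mono []      x≤y = z≤n
countᵇ-mono (a ∷ α) {x} {y} x≤y
  rewrite countᵇ-∷ (_<ᵇ x) a α | countᵇ-∷ (_<ᵇ y) a α = ℕₚ.+-mono-≤ first (countᵇ-mono α x≤y)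
  where
  first : (if a <ᵇ x then 1 else 0) ≤ (if a <ᵇ y then 1 else 0)
  first with a <ᵇ x in eq
  ... | false = z≤n
  ... | true rewrite <⇒<ᵇ≡true (ℕₚ.<-≤-trans (<ᵇ≡true⇒< a x eq) x≤y) = ≤-refl

-- Ranks grow weakly with the letter, so strict inequalities pull back; this reads the order of
-- letters off a reduced word.
rank-cancel-< : ∀ α {x y} → rank α x < rank α y → x < y
rank-cancel-< α lt = ℕₚ.≰⇒> (λ y≤x → ℕₚ.<⇒≱ lt (s≤s (countᵇ-mono α y≤x)))

red-increasing : ∀ {w} → AllPairs _<_ w → red w ≡ idPerm (length w)
red-increasing {[]}    []         = refl
red-increasing {x ∷ w} (x< ∷ inc) = begin
  rank (x ∷ w) x ∷ map (rank (x ∷ w)) w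
    ≡⟨ cong₂ _∷_ (cong suc (trans (skip {x} {x} ≤-refl w) (none (All.map ℕₚ.<⇒≤ x<)))) (map-cong-local (All.map (λ {y} → above {y}) x<)) ⟩
  1 ∷ map (λ y → suc (rank w y)) w     ≡⟨ cong (1 ∷_) (map-∘ w) ⟩
  1 ∷ map suc (red w)                  ≡⟨ cong (λ r → 1 ∷ map suc r) (red-increasing inc) ⟩
  1 ∷ map suc (idPerm (length w))      ≡⟨ cong (λ r → 1 ∷ map suc r) (map-upTo suc (length w)) ⟩
  idPerm (suc (length w))              ∎
  where
  skip : ∀ {x y} → x ≤ y → ∀ w → countᵇ (_<ᵇ x) (y ∷ w) ≡ countᵇ (_<ᵇ x) w
  skip {x} {y} x≤y w = trans (countᵇ-∷ (_<ᵇ x) y w) (cong (λ c → (if c then 1 else 0) + countᵇ (_<ᵇ x) w) (≤⇒<ᵇ≡false x≤y))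
  none : ∀ {w} → All (x ≤_) w → countᵇ (_<ᵇ x) w ≡ 0
  none []               = refl
  none {w = y ∷ w} (p ∷ ps) = trans (skip p w) (none ps)
  above : ∀ {y} → x < y → rank (x ∷ w) y ≡ suc (rank w y)
  above {y} x<y = cong suc (trans (countᵇ-∷ (_<ᵇ y) x w)
    (cong (λ c → (if c then 1 else 0) + countᵇ (_<ᵇ y) w) (<⇒<ᵇ≡true x<y)))

-- The four-letter match test seen from the state of `runs`: `p` and `b` have been read, the rest is
-- to come.
peak : Maybe ℕ → ℕ → List ℕ → Bool
peak p b []      = false
peak p b (x ∷ v) = (x <ᵇ b) ∧ rebound p x v

startsPeak : List ℕ → Bool
startsPeak (x ∷ y ∷ v) = peak (just x) y v
startsPeak _           = false

incPrefix : ℕ → List ℕ → Bool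
incPrefix zero          _           = true
incPrefix (suc k)       []          = false
incPrefix (suc zero)    (x ∷ _)     = true
incPrefix (suc (suc k)) (x ∷ [])    = false
incPrefix (suc (suc k)) (x ∷ y ∷ v) = (x <ᵇ y) ∧ incPrefix (suc k) (y ∷ v)

∈-inits⁻ : ∀ {w : List ℕ} l → w ∈ inits l → ∃[ r ] l ≡ w ++ r
∈-inits⁻ l       (here refl) = l , refl
∈-inits⁻ (x ∷ l) (there w∈) with ∈-map⁻ (x ∷_) w∈
... | w′ , w′∈ , refl with ∈-inits⁻ l w′∈
...   | r , refl = r , refl

∈-inits⁺ : ∀ (w r : List ℕ) → w ∈ inits (w ++ r)
∈-inits⁺ []      r = here refl
∈-inits⁺ (x ∷ w) r = there (∈-map⁺ (x ∷_) (∈-inits⁺ w r))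

matchHereᵇ⁻ : ∀ Γ l → T (matchHereᵇ Γ l) → ∃[ w ] ∃[ r ] (l ≡ w ++ r × red w ∈ Γ)
matchHereᵇ⁻ Γ l t with find (any⁻ _ (inits l) t)
... | w , w∈ , t∧ with ∈-inits⁻ l w∈
...   | r , eq = w , r , eq , Any.map (λ t′ → sym (toWitness t′)) (any⁻ _ Γ (proj₂ (Equivalence.to (T-∧ {2 ≤ᵇ length w}) t∧)))

matchHereᵇ⁺ : ∀ Γ w r → 2 ≤ length w → red w ∈ Γ → T (matchHereᵇ Γ (w ++ r))
matchHereᵇ⁺ Γ w r 2≤w red∈ = any⁺ _ (Any.map at-w (∈-inits⁺ w r))
  where
  at-w : ∀ {u} → w ≡ u → T ((2 ≤ᵇ length u) ∧ memᵇ (red u) Γ)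
  at-w refl = Equivalence.from T-∧ (ℕₚ.≤⇒≤ᵇ 2≤w , any⁺ _ (Any.map (λ eq → fromWitness (sym eq)) red∈))

T-ext : ∀ {a b} → (T a → T b) → (T b → T a) → a ≡ b
T-ext {true}  {true}  f g = refl
T-ext {true}  {false} f g = ⊥-elim (f _)
T-ext {false} {true}  f g = ⊥-elim (g _)
T-ext {false} {false} f g = refl

startsPeak⁺ : ∀ {p b x y} r → p < x → x < b → x < y → T (startsPeak (p ∷ b ∷ x ∷ y ∷ r))
startsPeak⁺ r p<x x<b x<y = Equivalence.from T-∧ (ℕₚ.<⇒<ᵇ x<b , Equivalence.from T-∧ (ℕₚ.<⇒<ᵇ p<x , ℕₚ.<⇒<ᵇ x<y))

-- The hypotheses are the inequalities common to the entries of 1324 and 1423, so both patterns are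
-- covered at once.
red-peak⁻ : ∀ {i j k l} w r → red w ≡ i ∷ j ∷ k ∷ l ∷ [] → i < k → k < j → k < l → T (startsPeak (w ++ r))
red-peak⁻ w r eq i<k k<j k<l with trans (sym (length-map (rank w) w)) (cong length eq)
red-peak⁻ (a ∷ b ∷ c ∷ d ∷ []) r eq i<k k<j k<l | refl = startsPeak⁺ {a} {b} {c} {d} r (lt a c i<k e₁ e₃) (lt c b k<j e₃ e₂) (lt c d k<l e₃ e₄)
  where
  w′ : List ℕ
  w′ = a ∷ b ∷ c ∷ d ∷ []
  e₁ = ∷-injectiveˡ eq
  e₂ = ∷-injectiveˡ (∷-injectiveʳ eq)
  e₃ = ∷-injectiveˡ (∷-injectiveʳ (∷-injectiveʳ eq))
  e₄ = ∷-injectiveˡ (∷-injectiveʳ (∷-injectiveʳ (∷-injectiveʳ eq)))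
  lt : ∀ {m n} x y → m < n → rank w′ x ≡ m → rank w′ y ≡ n → x < y
  lt x y m<n refl refl = rank-cancel-< w′ {x} {y} m<n

-- The identity is generalised to an increasing `f`, and the word `α` defining the ranks stays
-- fixed, so that letters can be peeled off `w`.
incPrefix-rank : ∀ α w r (f : ℕ → ℕ) k → (∀ i → f i < f (suc i)) → map (rank α) w ≡ applyUpTo f k → T (incPrefix k (w ++ r))
incPrefix-rank α w           r f zero          f< eq = _
incPrefix-rank α (x ∷ w)     r f (suc zero)    f< eq = _
incPrefix-rank α (x ∷ y ∷ w) r f (suc (suc k)) f< eq =
  Equivalence.from T-∧ (ℕₚ.<⇒<ᵇ (rank-cancel-< α {x} {y} (subst₂ _<_ (sym (∷-injectiveˡ eq)) (sym (∷-injectiveˡ (∷-injectiveʳ eq))) (f< 0))) ,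
    incPrefix-rank α (y ∷ w) r (f ∘ suc) (suc k) (f< ∘ suc) (∷-injectiveʳ eq))

red-idPerm⁻ : ∀ w r k → red w ≡ idPerm k → T (incPrefix k (w ++ r))
red-idPerm⁻ w r k eq = incPrefix-rank w w r suc k (λ i → ≤-refl) (trans eq (map-upTo suc k))

incPrefix⇒Linked : ∀ k l → T (incPrefix k l) → Linked _<_ (take k l)
incPrefix⇒Linked zero          l           t = []
incPrefix⇒Linked (suc zero)    (x ∷ l)     t = [-]
incPrefix⇒Linked (suc (suc k)) (x ∷ y ∷ l) t =
  ℕₚ.<ᵇ⇒< x y (proj₁ (Equivalence.to (T-∧ {x <ᵇ y}) t))
  ∷ incPrefix⇒Linked (suc k) (y ∷ l) (proj₂ (Equivalence.to (T-∧ {x <ᵇ y}) t))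

incPrefix⇒length : ∀ k l → T (incPrefix k l) → length (take k l) ≡ k
incPrefix⇒length zero          l           t = refl
incPrefix⇒length (suc zero)    (x ∷ l)     t = refl
incPrefix⇒length (suc (suc k)) (x ∷ y ∷ l) t =
  cong suc (incPrefix⇒length (suc k) (y ∷ l) (proj₂ (Equivalence.to (T-∧ {x <ᵇ y}) t)))

bit : Bool → ℕ
bit c = if c then 1 else 0

rank-4 : ∀ z p b x y {c₁ c₂ c₃ c₄} → (p <ᵇ z) ≡ c₁ → (b <ᵇ z) ≡ c₂ → (x <ᵇ z) ≡ c₃ → (y <ᵇ z) ≡ c₄ →
  rank (p ∷ b ∷ x ∷ y ∷ []) z ≡ suc (bit c₁ + (bit c₂ + (bit c₃ + (bit c₄ + 0))))
rank-4 z p b x y refl refl refl refl = cong suc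
  (trans (countᵇ-∷ (_<ᵇ z) p _) (cong (_+_ (bit (p <ᵇ z)))
  (trans (countᵇ-∷ (_<ᵇ z) b _) (cong (_+_ (bit (b <ᵇ z)))
  (trans (countᵇ-∷ (_<ᵇ z) x _) (cong (_+_ (bit (x <ᵇ z)))
         (countᵇ-∷ (_<ᵇ z) y [])))))))

private
  yes′ : ∀ {m n} → m < n → (m <ᵇ n) ≡ true
  yes′ = <⇒<ᵇ≡true
  no′ : ∀ {m n} → n < m → (m <ᵇ n) ≡ false
  no′ n<m = ≤⇒<ᵇ≡false (ℕₚ.<⇒≤ n<m)
  irr : ∀ n → (n <ᵇ n) ≡ false
  irr n = ≤⇒<ᵇ≡false (≤-refl {n})
  list-4 : ∀ {a b c d a′ b′ c′ d′ : ℕ} → a ≡ a′ → b ≡ b′ → c ≡ c′ → d ≡ d′ →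
    _≡_ {A = List ℕ} (a ∷ b ∷ c ∷ d ∷ []) (a′ ∷ b′ ∷ c′ ∷ d′ ∷ [])
  list-4 refl refl refl refl = refl

red-1324⁺ : ∀ {p b x y} → p < x → x < b → b < y → red (p ∷ b ∷ x ∷ y ∷ []) ≡ 1 ∷ 3 ∷ 2 ∷ 4 ∷ []
red-1324⁺ {p} {b} {x} {y} p<x x<b b<y = list-4
  (rank-4 p p b x y (irr p) (no′ p<b) (no′ p<x) (no′ p<y))
  (rank-4 b p b x y (yes′ p<b) (irr b) (yes′ x<b) (no′ b<y))
  (rank-4 x p b x y (yes′ p<x) (no′ x<b) (irr x) (no′ x<y))
  (rank-4 y p b x y (yes′ p<y) (yes′ b<y) (yes′ x<y) (irr y))
  where
  p<b = ℕₚ.<-trans p<x x<b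
  x<y = ℕₚ.<-trans x<b b<y
  p<y = ℕₚ.<-trans p<b b<y

red-1423⁺ : ∀ {p b x y} → p < x → x < y → y < b → red (p ∷ b ∷ x ∷ y ∷ []) ≡ 1 ∷ 4 ∷ 2 ∷ 3 ∷ []
red-1423⁺ {p} {b} {x} {y} p<x x<y y<b = list-4
  (rank-4 p p b x y (irr p) (no′ p<b) (no′ p<x) (no′ p<y))
  (rank-4 b p b x y (yes′ p<b) (irr b) (yes′ x<b) (yes′ y<b))
  (rank-4 x p b x y (yes′ p<x) (no′ x<b) (irr x) (no′ x<y))
  (rank-4 y p b x y (yes′ p<y) (no′ y<b) (yes′ x<y) (irr y))
  where
  x<b = ℕₚ.<-trans x<y y<b
  p<y = ℕₚ.<-trans p<x x<y
  p<b = ℕₚ.<-trans p<y y<b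

-- Replaces the search through prefixes and patterns by two order tests. In the converse direction
-- distinctness gives `b ≢ y`, and the order of these two letters selects 1324 or 1423.
matchHereᵇ-Γ₂₂ : ∀ s l → 1 ≤ s → Unique l → matchHereᵇ (Γ₂₂ s) l ≡ startsPeak l ∨ incPrefix (suc s) l
matchHereᵇ-Γ₂₂ s l 1≤s unique = T-ext to (from l unique)
  where
  to : T (matchHereᵇ (Γ₂₂ s) l) → T (startsPeak l ∨ incPrefix (suc s) l)
  to t with matchHereᵇ⁻ (Γ₂₂ s) l t
  ... | w , r , refl , here eq                 = Equivalence.from T-∨ (inj₁ (red-peak⁻ w r eq (s≤s (s≤s z≤n)) (s≤s (s≤s (s≤s z≤n))) (s≤s (s≤s (s≤s z≤n)))))
  ... | w , r , refl , there (here eq)         = Equivalence.from T-∨ (inj₁ (red-peak⁻ w r eq (s≤s (s≤s z≤n)) (s≤s (s≤s (s≤s z≤n))) (s≤s (s≤s (s≤s z≤n)))))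
  ... | w , r , refl , there (there (here eq)) = Equivalence.from (T-∨ {startsPeak l}) (inj₂ (red-idPerm⁻ w r (suc s) eq))
  fromPeak : ∀ l → Unique l → T (startsPeak l) → T (matchHereᵇ (Γ₂₂ s) l)
  fromPeak (p ∷ b ∷ x ∷ y ∷ r) (_ ∷ (_ ∷ b≢y ∷ _) ∷ _) t with Equivalence.to (T-∧ {x <ᵇ b}) t
  ... | x<b , t′ with Equivalence.to (T-∧ {p <ᵇ x}) t′
  ...   | p<x , x<y with ℕₚ.<-cmp b y
  ...     | tri< b<y _ _ = matchHereᵇ⁺ (Γ₂₂ s) (p ∷ b ∷ x ∷ y ∷ []) r (s≤s (s≤s z≤n))
              (here (red-1324⁺ (ℕₚ.<ᵇ⇒< p x p<x) (ℕₚ.<ᵇ⇒< x b x<b) b<y))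
  ...     | tri≈ _ b≡y _ = ⊥-elim (b≢y b≡y)
  ...     | tri> _ _ y<b = matchHereᵇ⁺ (Γ₂₂ s) (p ∷ b ∷ x ∷ y ∷ []) r (s≤s (s≤s z≤n))
              (there (here (red-1423⁺ (ℕₚ.<ᵇ⇒< p x p<x) (ℕₚ.<ᵇ⇒< x y x<y) y<b)))
  fromPeak (p ∷ b ∷ x ∷ []) _ t with x <ᵇ b
  fromPeak (p ∷ b ∷ x ∷ []) _ () | true
  fromPeak (p ∷ b ∷ x ∷ []) _ () | false
  fromInc : ∀ l → T (incPrefix (suc s) l) → T (matchHereᵇ (Γ₂₂ s) l)
  fromInc l t = subst (T ∘ matchHereᵇ (Γ₂₂ s)) (take++drop≡id (suc s) l)
    (matchHereᵇ⁺ (Γ₂₂ s) (take (suc s) l) (drop (suc s) l) (subst (2 ≤_) (sym len) (s≤s 1≤s))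
      (there (there (here (trans (red-increasing (Linked⇒AllPairs ℕₚ.<-trans (incPrefix⇒Linked (suc s) l t))) (cong idPerm len))))))
    where
    len = incPrefix⇒length (suc s) l t
  from : ∀ l → Unique l → T (startsPeak l ∨ incPrefix (suc s) l) → T (matchHereᵇ (Γ₂₂ s) l)
  from l unique t with Equivalence.to (T-∨ {startsPeak l}) t
  ... | inj₁ t′ = fromPeak l unique t′
  ... | inj₂ t′ = fromInc l t′

unique-insertions : ∀ {M v} → All (_< M) v → Unique v → All Unique (insertions M v)
unique-insertions []          []          = ([] ∷ []) ∷ []
unique-insertions {M} {x ∷ v} (x<M ∷ v<M) (x≢ ∷ uniq) =
  (All.map (λ y<M M≡y → ℕₚ.<⇒≢ y<M (sym M≡y)) (x<M ∷ v<M) ∷ (x≢ ∷ uniq))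
  ∷ map⁺ (All.zipWith (λ (p , q) → p ∷ q) (All-insertions {P = x ≢_} (ℕₚ.<⇒≢ x<M) x≢ , unique-insertions v<M uniq))

perms-unique : ∀ n → All Unique (perms n)
perms-unique zero    = [] ∷ []
perms-unique (suc n) =
  All-concatMap {P = λ v → All (_< suc n) v × Unique v} (λ (b , u) → unique-insertions b u)
    (All.zip (perms-bounded n , perms-unique n))

-- Match avoidance and `runs`

monomial : ℕ → Poly
monomial k j = if k ≡ᵇ j then + 1 else + 0

shift-oneP : shift oneP ≐ monomial 1
shift-oneP zero          = refl
shift-oneP (suc zero)    = refl
shift-oneP (suc (suc j)) = refl

shift-monomial : ∀ k → shift (monomial k) ≐ monomial (suc k)
shift-monomial k zero    = refl
shift-monomial k (suc j) = refl

guard : Bool → Poly → Poly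
guard c p = if c then p else zeroP

shift-guard : ∀ c k → shift (guard c (monomial k)) ≐ guard c (monomial (suc k))
shift-guard true  k         = shift-monomial k
shift-guard false k zero    = refl
shift-guard false k (suc j) = refl

incPrefix-≤ : ∀ {k l} → k ≤ l → ∀ w → incPrefix l w ≡ true → incPrefix k w ≡ true
incPrefix-≤ {zero}        k≤l             w           t = refl
incPrefix-≤ {suc zero}    {suc l} k≤l     (x ∷ w)     t = refl
incPrefix-≤ {suc (suc k)} (s≤s (s≤s k≤l)) (x ∷ y ∷ w) t =
  ∧-map (x <ᵇ y) (incPrefix-≤ (s≤s k≤l) (y ∷ w)) t
  where
  ∧-map : ∀ a {b c} → (b ≡ true → c ≡ true) → a ∧ b ≡ true → a ∧ c ≡ true
  ∧-map true f t = f t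

peak-nothing : ∀ b v → peak nothing b v ≡ false
peak-nothing b []      = refl
peak-nothing b (x ∷ v) = ∧-zeroʳ (x <ᵇ b)

-- A match on `b x y z` would need `b < y < x`. This justifies forgetting `b` when a new run starts
-- after a descent.
peak-descent : ∀ {b x} → x ≤ b → ∀ v → peak (just b) x v ≡ false
peak-descent x≤b []      = refl
peak-descent {b} {x} x≤b (y ∷ v) with y <ᵇ x in y<x
... | false = refl
peak-descent x≤b (y ∷ [])    | true = refl
peak-descent {b} {x} x≤b (y ∷ z ∷ v) | true
  rewrite ≤⇒<ᵇ≡false (ℕₚ.<⇒≤ (ℕₚ.<-≤-trans (<ᵇ≡true⇒< y x y<x) x≤b)) = refl

module _ (e : ℕ) where
  open Bricks e

  avoids : List ℕ → Bool
  avoids []      = true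
  avoids (x ∷ w) = not (startsPeak (x ∷ w) ∨ incPrefix (3 + e) (x ∷ w)) ∧ avoids w

  noMatchᵇ-avoids : ∀ w → Unique w → noMatchᵇ (Γ₂₂ (2 + e)) w ≡ avoids w
  noMatchᵇ-avoids []      _             = refl
  noMatchᵇ-avoids (x ∷ w) u@(_ ∷ uniq) = trans
    (deMorgan (matchHereᵇ (Γ₂₂ (2 + e)) (x ∷ w)) _)
    (cong₂ (λ m n → not m ∧ n) (matchHereᵇ-Γ₂₂ (2 + e) (x ∷ w) (s≤s z≤n) u) (noMatchᵇ-avoids w uniq))
    where
    deMorgan : ∀ a b → not (a ∨ b) ≡ not a ∧ not b
    deMorgan true  b = refl
    deMorgan false b = refl

  -- Besides matches within `b ∷ v`, two may begin earlier: a peak starting at `p`, and an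
  -- increasing match from the start of the run, completed by `suc d` further ascending letters.
  admits : Maybe ℕ → ℕ → ℕ → List ℕ → Bool
  admits p d b v = not (peak p b v) ∧ (not (incPrefix (2 + d) (b ∷ v)) ∧ avoids (b ∷ v))

  admits-nothing : ∀ b v → admits nothing (suc e) b v ≡ avoids (b ∷ v)
  admits-nothing b v rewrite peak-nothing b v = absorb (startsPeak (b ∷ v)) (incPrefix (3 + e) (b ∷ v)) (avoids v)
    where
    absorb : ∀ a i n → not i ∧ (not (a ∨ i) ∧ n) ≡ not (a ∨ i) ∧ n
    absorb true  true  n = refl
    absorb true  false n = refl
    absorb false true  n = refl
    absorb false false n = refl

  -- By `d ≤ suc e` the current run has no more room than a fresh one, so its own bound already
  -- excludes increasing matches that start inside it.
  runs-admits : ∀ p d b v → d ≤ suc e → Unique (b ∷ v) →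
    runs p d b v ≐ guard (admits p d b v) (monomial (suc (des (b ∷ v))))
  runs-admits p d b []      d≤ _ = shift-oneP
  runs-admits p d b (x ∷ v) d≤ ((b≢x ∷ _) ∷ uniq) j with b <ᵇ x in eq
  runs-admits p zero b (x ∷ v) d≤ ((b≢x ∷ _) ∷ uniq) j | true
    rewrite ≤⇒<ᵇ≡false (ℕₚ.<⇒≤ (<ᵇ≡true⇒< b x eq)) = refl
  runs-admits p (suc d) b (x ∷ v) (s≤s d≤e) ((b≢x ∷ _) ∷ uniq) j | true
    rewrite ≤⇒<ᵇ≡false (ℕₚ.<⇒≤ (<ᵇ≡true⇒< b x eq)) =
    trans (runs-admits (just b) d x v (ℕₚ.m≤n⇒m≤1+n d≤e) uniq j)
      (cong (λ c → guard c (monomial (suc (des (x ∷ v)))) j)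
        (rearrange (peak (just b) x v) (incPrefix (2 + d) (x ∷ v)) (incPrefix (2 + e) (x ∷ v)) (avoids (x ∷ v))
          (incPrefix-≤ (s≤s (s≤s d≤e)) (x ∷ v))))
    where
    rearrange : ∀ a i i′ n → (i′ ≡ true → i ≡ true) → not a ∧ (not i ∧ n) ≡ not i ∧ (not (a ∨ i′) ∧ n)
    rearrange a     true  i′    n imp = ∧-zeroʳ (not a)
    rearrange true  false i′    n imp = refl
    rearrange false false false n imp = refl
    rearrange false false true  n imp with () ← imp refl
  -- Distinctness makes the descent strict. No match starts at `b`, and the test `peak p b` reduces
  -- to `rebound`.
  runs-admits p d b (x ∷ v) d≤ ((b≢x ∷ _) ∷ uniq) j | false
    rewrite <⇒<ᵇ≡true (ℕₚ.≤∧≢⇒< (<ᵇ≡false⇒≥ b x eq) (λ x≡b → b≢x (sym x≡b)))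
          | peak-descent (<ᵇ≡false⇒≥ b x eq) v with rebound p x v
  ... | true  = refl
  ... | false = begin
    shift (runs nothing (suc e) x v) j
      ≡⟨ shift-cong (runs-admits nothing (suc e) x v ≤-refl uniq) j ⟩
    shift (guard (admits nothing (suc e) x v) (monomial (suc (des (x ∷ v))))) j
      ≡⟨ cong (λ c → shift (guard c (monomial (suc (des (x ∷ v))))) j) (admits-nothing x v) ⟩
    shift (guard (avoids (x ∷ v)) (monomial (suc (des (x ∷ v))))) j
      ≡⟨ shift-guard (avoids (x ∷ v)) (suc (des (x ∷ v))) j ⟩
    guard (avoids (x ∷ v)) (monomial (2 + des (x ∷ v))) j ∎

  F-noMatch : ∀ x v → Unique (x ∷ v) → ∀ j →
    F (x ∷ v) j ≡ (if noMatchᵇ (Γ₂₂ (2 + e)) (x ∷ v) ∧ (suc (des (x ∷ v)) ≡ᵇ j) then + 1 else + 0)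
  F-noMatch x v uniq j = begin
    runs nothing (suc e) x v j
      ≡⟨ runs-admits nothing (suc e) x v ≤-refl uniq j ⟩
    guard (admits nothing (suc e) x v) (monomial (suc (des (x ∷ v)))) j
      ≡⟨ cong (λ c → guard c (monomial (suc (des (x ∷ v)))) j)
           (trans (admits-nothing x v) (sym (noMatchᵇ-avoids (x ∷ v) uniq))) ⟩
    guard (noMatchᵇ (Γ₂₂ (2 + e)) (x ∷ v)) (monomial (suc (des (x ∷ v)))) j
      ≡⟨ nested (noMatchᵇ (Γ₂₂ (2 + e)) (x ∷ v)) (suc (des (x ∷ v))) ⟩
    (if noMatchᵇ (Γ₂₂ (2 + e)) (x ∷ v) ∧ (suc (des (x ∷ v)) ≡ᵇ j) then + 1 else + 0) ∎
    where
    nested : ∀ c k → guard c (monomial k) j ≡ (if c ∧ (k ≡ᵇ j) then + 1 else + 0)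
    nested true  k = refl
    nested false k = refl

  A≐totalF : ∀ k → A (Γ₂₂ (2 + e)) (suc k) ≐ totalF (suc k)
  A≐totalF k j = begin
    + length (filterᵇ q (perms (suc k)))                       ≡⟨ length-filterᵇ (perms (suc k)) ⟩
    sumOver (λ σ → if q σ then + 1 else + 0) (perms (suc k))   ≡⟨ sumOver-cong (perms (suc k)) (All.map pointwise nonempty) ⟩
    sumOver (λ σ → F σ j) (perms (suc k))                      ≡⟨ sumOver-perms (F-invariant j) (suc k) ⟩
    totalF (suc k) j                                           ∎
    where
    q : List ℕ → Bool
    q σ = noMatchᵇ (Γ₂₂ (2 + e)) σ ∧ (suc (des σ) ≡ᵇ j)
    length-filterᵇ : ∀ σs → + length (filterᵇ q σs) ≡ sumOver (λ σ → if q σ then + 1 else + 0) σs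
    length-filterᵇ []       = refl
    length-filterᵇ (σ ∷ σs) with q σ
    ... | true  = cong (ℤ._+_ (+ 1)) (length-filterᵇ σs)
    ... | false = trans (length-filterᵇ σs) (sym (ℤₚ.+-identityˡ _))
    NonEmpty : List ℕ → Set
    NonEmpty σ = 1 ≤ length σ
    insertions-nonempty : ∀ M v → All NonEmpty (insertions M v)
    insertions-nonempty M []      = s≤s z≤n ∷ []
    insertions-nonempty M (x ∷ v) = s≤s z≤n ∷ map⁺ (All.universal (λ _ → s≤s z≤n) (insertions M v))
    nonempty : All (λ σ → NonEmpty σ × Unique σ) (perms (suc k))
    nonempty = All.zip (All-concatMap {P = λ v → All (_< suc k) v} (λ {v} _ → insertions-nonempty (suc k) v) (perms-bounded k)
                       , perms-unique (suc k))
    pointwise : ∀ {σ} → NonEmpty σ × Unique σ → (if q σ then + 1 else + 0) ≡ F σ j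
    pointwise {x ∷ v} (_ , uniq) = sym (F-noMatch x v uniq j)

-- Extremal coefficients

below-trans : ∀ {p x} → p < x → ∀ v → below x v ≡ true → below p v ≡ true
below-trans p<x []      t = refl
below-trans {p} {x} p<x (y ∷ v) t with x <ᵇ y in eq
... | true rewrite <⇒<ᵇ≡true (ℕₚ.<-trans p<x (<ᵇ≡true⇒< x y eq)) = below-trans p<x v t

minFirsts : ℕ → (List ℕ → ℤ) → List ℕ → ℤ
minFirsts zero    φ = φ
minFirsts (suc k) φ = minFirst (minFirsts k φ)

minFirsts-invariant : ∀ k {φ} → Invariant φ → Invariant (minFirsts k φ)
minFirsts-invariant zero    inv = inv
minFirsts-invariant (suc k) inv = minFirst-invariant (minFirsts-invariant k inv)

total-minFirsts : ∀ k n {φ} → Invariant φ → total (minFirsts k φ) (k + n) ≡ total φ n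
total-minFirsts zero    n inv = refl
total-minFirsts (suc k) n inv =
  trans (total-minFirst (k + n) (minFirsts-invariant k inv)) (total-minFirsts k n inv)

-- If `b` lies below `v`, then so does any `p < b`: along an increasing brick, minimality of the
-- later letter implies that of the earlier one.
minFirst-absorb : ∀ φ {p b} → p < b → ∀ v → minFirst (minFirst φ) (p ∷ b ∷ v) ≡ minFirst φ (b ∷ v)
minFirst-absorb φ {p} {b} p<b v rewrite <⇒<ᵇ≡true p<b with below b v in eq
... | true  rewrite below-trans p<b v eq = refl
... | false with below p v
...   | true  = refl
...   | false = refl

module Extremal (t : ℕ) where
  e s : ℕ
  e = suc t
  s = 2 + e
  open Bricks e

  private
    room : ∀ d j n → d + s * suc j < suc n + s → suc e + s * j < n + s
    room d j n lt = ℕₚ.≤-pred (≤-trans (s≤s (≤-trans (ℕₚ.≤-reflexive (sym (ℕₚ.*-suc s j))) (ℕₚ.m≤n+m (s * suc j) d))) lt)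

  -- The current brick takes at most `d` letters of `v`, and each of the other `j - 1` bricks at
  -- most `s`. Adding `s` to both sides avoids subtraction.
  bricks-vanish : ∀ m p d b v j → d + s * j < length v + s → bricks m p d b v j ≡ + 0
  shift-vanish : ∀ m d x v j → d + s * j < suc (length v) + s → shift (bricks m nothing (suc e) x v) j ≡ + 0

  bricks-vanish true  p d b [] j    lt = refl
  bricks-vanish false p d b [] zero lt = refl
  bricks-vanish false p d b [] (suc j) lt =
    contradiction (≤-trans (ℕₚ.m≤m*n s (suc j)) (ℕₚ.m≤n+m (s * suc j) d)) (ℕₚ.<⇒≱ lt)
  bricks-vanish m p d b (x ∷ v) j lt with b <ᵇ x
  bricks-vanish m p d b (x ∷ v) j lt | true = cong₂ ℤ._+_ (continue d lt) (close m)
    where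
    continue : ∀ d → d + s * j < suc (length v) + s → atSuc d (λ d′ → bricks false (just b) d′ x v) j ≡ + 0
    continue zero    lt = refl
    continue (suc d) lt = bricks-vanish false (just b) d x v j (ℕₚ.≤-pred lt)
    close : ∀ m → (if m then zeroP else neg (shift (bricks false nothing (suc e) x v))) j ≡ + 0
    close true  = refl
    close false = cong -_ (shift-vanish false d x v j lt)
  bricks-vanish m p d b (x ∷ v) j lt | false with not m ∧ belowMaybe p x
  ... | true  = cong -_ (shift-vanish true d x v j lt)
  ... | false = refl

  shift-vanish m d x v zero    lt = refl
  shift-vanish m d x v (suc j) lt = bricks-vanish m nothing (suc e) x v j (room d j (length v) lt)

  next-vanish : ∀ m x v j → s * j < suc (length v) → bricks m nothing (suc e) x v j ≡ + 0
  next-vanish m x v j lt = bricks-vanish m nothing (suc e) x v j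
    (≤-trans (ℕₚ.≤-reflexive (sym (ℕₚ.+-suc (suc e) (s * j))))
      (≤-trans (ℕₚ.+-monoʳ-≤ (suc e) lt)
        (ℕₚ.≤-reflexive (trans (ℕₚ.+-suc (suc e) (length v)) (ℕₚ.+-comm s (length v))))))

  G-vanish : ∀ w j → s * j < length w → G w j ≡ + 0
  G-vanish (x ∷ v) j lt = next-vanish false x v j lt

  -- The bound says that `x ∷ v` has at least `s * j - 1` letters, the smaller extremal length. This
  -- is the induction hypothesis for words with one brick more.
  MinHead : ℕ → Set
  MinHead j = ∀ x v → s * j ≤ 2 + length v → below x v ≡ false → G (x ∷ v) j ≡ + 0

  -- The flag only forbids a first brick of one letter. Such a brick would leave at least
  -- `s * j - 2` letters to `j - 1` bricks, too many because `s` is at least 3.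
  bricks-true : ∀ x v j → s * j ≤ 2 + length v → bricks true nothing (suc e) x v j ≡ G (x ∷ v) j
  bricks-true x []      zero    le = refl
  bricks-true x []      (suc j) le =
    contradiction (≤-trans (ℕₚ.m≤m*n s (suc j)) le) (ℕₚ.<⇒≱ (s≤s (s≤s (s≤s z≤n))))
  bricks-true x (y ∷ v) j le with x <ᵇ y
  ... | false = refl
  ... | true  = cong (λ z → bricks false (just x) e y v j ℤ.+ z) (sym (cong -_ (closed j le)))
    where
    closed : ∀ j → s * j ≤ 3 + length v → shift (bricks false nothing (suc e) y v) j ≡ + 0
    closed zero    le = refl
    closed (suc j) le = next-vanish false y v j
      (s≤s (≤-trans (ℕₚ.m≤n+m (s * j) t) (ℕₚ.+-cancelˡ-≤ 3 (t + s * j) (length v)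
        (≤-trans (ℕₚ.≤-reflexive (sym (ℕₚ.*-suc s j))) le))))

  bricks-ascent : ∀ p d {b x} v → b < x →
    bricks false p (suc d) b (x ∷ v) ≐ bricks false (just b) d x v ⊕ neg (shift (G (x ∷ v)))
  bricks-ascent p d v b<x j rewrite <⇒<ᵇ≡true b<x = refl

  module _ (j : ℕ) (minHead : MinHead j) where

    -- After e letters, a first brick of length s has two letters left and one of length s - 1 has one left;
    -- its last letter is unconstrained.
    rest first : List ℕ → ℤ
    rest  = dropFirst (λ v → - G v j)
    first w = minFirst rest w ℤ.+ rest w

    -- By `minHead` the term vanishes unless `x` is the least letter of `x ∷ v`, and then `p < x`
    -- puts `p` below everything. Local comparisons at a boundary become global ones in this way.
    linked : ∀ {p x} v → p < x → s * j ≤ 2 + length v →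
      (if below p (x ∷ v) then - G (x ∷ v) j else + 0) ≡ - G (x ∷ v) j
    linked {p} {x} v p<x le rewrite <⇒<ᵇ≡true p<x with below p v in eq
    ... | true  = refl
    ... | false with below x v in eq′
    ...   | true  = contradiction (trans (sym eq) (below-trans p<x v eq′)) (λ ())
    ...   | false = sym (cong -_ (minHead x v le eq′))

    afterDescent : ∀ p x v → s * j ≤ 2 + length v →
      (if p <ᵇ x then neg (shift (bricks true nothing (suc e) x v)) else zeroP) (suc j)
      ≡ (if below p (x ∷ v) then - G (x ∷ v) j else + 0)
    afterDescent p x v le with p <ᵇ x in eq
    ... | false = refl
    ... | true  = trans (cong -_ (bricks-true x v j le))
      (sym (trans (cong (λ c → if c ∧ below p v then - G (x ∷ v) j else + 0) (sym eq)) (linked v (<ᵇ≡true⇒< p x eq) le)))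

    -- The brick must end at `b`. At an ascent `p < b < x` is automatic, at a descent `p < x` is the
    -- rule for the boundary; in both cases `b` itself is free.
    fullBrick : ∀ {p b} v → p < b → s * j ≤ suc (length v) →
      bricks false (just p) 0 b v (suc j) ≡ minFirst rest (p ∷ b ∷ v)
    fullBrick {p} {b} []      p<b le rewrite <⇒<ᵇ≡true p<b = refl
    fullBrick {p} {b} (x ∷ v) p<b le rewrite <⇒<ᵇ≡true p<b with b <ᵇ x in eq
    ... | true  = trans (ℤₚ.+-identityˡ _) (sym (linked v (ℕₚ.<-trans p<b (<ᵇ≡true⇒< b x eq)) le))
    ... | false = afterDescent p x v le

    -- The brick takes one more letter, giving the summand `minFirst rest`, or ends at `b`, giving
    -- `rest`. At a descent the former summand is zero, as `b` is not minimal.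
    shortBrick : ∀ {p b} v → p < b → s * j ≤ length v →
      bricks false (just p) 1 b v (suc j) ≡ minFirst first (p ∷ b ∷ v)
    shortBrick {p} {b} []      p<b le rewrite <⇒<ᵇ≡true p<b = sym (ℤₚ.+-identityˡ _)
    shortBrick {p} {b} (x ∷ v) p<b le with b ℕ.<? x
    ... | yes b<x = begin
      bricks false (just p) 1 b (x ∷ v) (suc j)
        ≡⟨ bricks-ascent (just p) 0 v b<x (suc j) ⟩
      bricks false (just b) 0 x v (suc j) ℤ.+ - G (x ∷ v) j
        ≡⟨ cong₂ ℤ._+_ (trans (fullBrick v b<x le) (sym (minFirst-absorb rest p<b (x ∷ v))))
                       (sym (linked v (ℕₚ.<-trans p<b b<x) (ℕₚ.m≤n⇒m≤1+n le))) ⟩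
      (if below p (b ∷ x ∷ v) then minFirst rest (b ∷ x ∷ v) else + 0) ℤ.+ (if below p (x ∷ v) then - G (x ∷ v) j else + 0)
        ≡⟨ cong (λ c → (if below p (b ∷ x ∷ v) then minFirst rest (b ∷ x ∷ v) else + 0)
                       ℤ.+ (if c ∧ below p (x ∷ v) then - G (x ∷ v) j else + 0)) (sym (<⇒<ᵇ≡true p<b)) ⟩
      (if below p (b ∷ x ∷ v) then minFirst rest (b ∷ x ∷ v) else + 0) ℤ.+ (if below p (b ∷ x ∷ v) then - G (x ∷ v) j else + 0)
        ≡⟨ if-+ (below p (b ∷ x ∷ v)) (minFirst rest (b ∷ x ∷ v)) (- G (x ∷ v) j) ⟩
      minFirst first (p ∷ b ∷ x ∷ v) ∎
      where
      if-+ : ∀ c y z → (if c then y else + 0) ℤ.+ (if c then z else + 0) ≡ (if c then y ℤ.+ z else + 0)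
      if-+ true  y z = refl
      if-+ false y z = refl
    ... | no b≮x rewrite <⇒<ᵇ≡true p<b | ≤⇒<ᵇ≡false (ℕₚ.≮⇒≥ b≮x) =
      trans (afterDescent p x v (ℕₚ.m≤n⇒m≤1+n le))
            (cong (λ z → if below p (x ∷ v) then z else + 0) (sym (ℤₚ.+-identityˡ (- G (x ∷ v) j))))

    -- Ending the brick at `b` would leave more than `s * j` letters to `j` bricks, so it continues
    -- by an ascent, and `b` lies below all that follows.
    longBrick : ∀ k p b x v → s * j + k ≤ length v →
      bricks false p (2 + k) b (x ∷ v) (suc j) ≡ minFirsts (suc k) first (b ∷ x ∷ v)
    partBrick : ∀ k {p b} v → p < b → s * j + k ≤ length v →
      bricks false (just p) (suc k) b v (suc j) ≡ minFirsts (suc k) first (p ∷ b ∷ v)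

    partBrick zero    v p<b le = shortBrick v p<b (subst (_≤ length v) (ℕₚ.+-identityʳ (s * j)) le)
    partBrick (suc k) [] p<b le = contradiction (≤-trans (ℕₚ.m≤n+m (suc k) (s * j)) le) (λ ())
    partBrick (suc k) {p} {b} (x ∷ v) p<b le =
      trans (longBrick k (just p) b x v (ℕₚ.≤-pred (≤-trans (ℕₚ.≤-reflexive (sym (ℕₚ.+-suc (s * j) k))) le)))
            (sym (minFirst-absorb (minFirsts k first) p<b (x ∷ v)))

    longBrick k p b x v le with b ℕ.<? x
    ... | yes b<x = begin
      bricks false p (2 + k) b (x ∷ v) (suc j)
        ≡⟨ bricks-ascent p (suc k) v b<x (suc j) ⟩
      bricks false (just b) (suc k) x v (suc j) ℤ.+ - G (x ∷ v) j
        ≡⟨ cong₂ ℤ._+_ (partBrick k v b<x le) (cong -_ (G-vanish (x ∷ v) j (s≤s (ℕₚ.m+n≤o⇒m≤o (s * j) le)))) ⟩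
      minFirsts (suc k) first (b ∷ x ∷ v) ℤ.+ + 0
        ≡⟨ ℤₚ.+-identityʳ _ ⟩
      minFirsts (suc k) first (b ∷ x ∷ v) ∎
    ... | no b≮x rewrite ≤⇒<ᵇ≡false (ℕₚ.≮⇒≥ b≮x) with belowMaybe p x
    ...   | true  = cong -_ (next-vanish true x v j (s≤s (ℕₚ.m+n≤o⇒m≤o (s * j) le)))
    ...   | false = refl

    -- The first brick begins with room for `2 + t` more letters, so its first `e` letters are
    -- successive minima of what remains; `first` treats its end.
    G-suc : ∀ w → s * suc j ≤ suc (length w) → G w (suc j) ≡ minFirsts e first w
    G-suc w le = go w (≤-trans (ℕₚ.≤-reflexive (sym (ℕₚ.*-suc s j))) le)
      where
      go : ∀ w → s + s * j ≤ suc (length w) → G w (suc j) ≡ minFirsts e first w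
      go []          (s≤s ())
      go (x ∷ [])    (s≤s (s≤s ()))
      go (x ∷ y ∷ v) (s≤s (s≤s (s≤s le))) =
        longBrick t nothing x y v (≤-trans (ℕₚ.≤-reflexive (ℕₚ.+-comm (s * j) t)) le)

    rest-invariant : Invariant rest
    rest-invariant = dropFirst-invariant (λ v~w → cong -_ (G-invariant j v~w))

    total-rest : ∀ n → total rest (suc n) ≡ + suc n ℤ.* - totalG n j
    total-rest n = trans (total-dropFirst n (λ v~w → cong -_ (G-invariant j v~w)))
                         (cong (ℤ._*_ (+ suc n)) (total-neg n (λ v → G v j)))

    -- The `e` forced minima leave the total unchanged. The summands belong to a first brick of
    -- length `s`, followed by `m - 1` letters, and to one of length `s - 1`, followed by `m`
    -- letters.
    totalG-step : ∀ m → s * j ≤ m → totalG (e + suc m) (suc j) ≡ total rest m ℤ.+ total rest (suc m)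
    totalG-step m le = begin
      totalG (e + suc m) (suc j)
        ≡⟨ total-length-cong (e + suc m) (λ w len → G-suc w (enough w len)) ⟩
      total (minFirsts e first) (e + suc m)
        ≡⟨ total-minFirsts e (suc m) (λ v~w → cong₂ ℤ._+_ (minFirst-invariant rest-invariant v~w) (rest-invariant v~w)) ⟩
      total first (suc m)
        ≡⟨ total-+ (suc m) (minFirst rest) rest ⟩
      total (minFirst rest) (suc m) ℤ.+ total rest (suc m)
        ≡⟨ cong (ℤ._+ total rest (suc m)) (total-minFirst m rest-invariant) ⟩
      total rest m ℤ.+ total rest (suc m) ∎
      where
      enough : ∀ w → length w ≡ e + suc m → s * suc j ≤ suc (length w)
      enough w len = ≤-trans (ℕₚ.≤-reflexive (ℕₚ.*-suc s j)) (≤-trans (ℕₚ.+-monoʳ-≤ s le)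
        (ℕₚ.≤-reflexive (cong suc (sym (trans len (ℕₚ.+-suc e m))))))

  -- As `e` is at least 1, `G-suc` exhibits an outer `minFirst`, which is the property for the next
  -- `j`.
  minHead : ∀ j → MinHead j
  minHead zero    x v le eq = G-vanish (x ∷ v) 0 (subst (_< suc (length v)) (sym (ℕₚ.*-zeroʳ s)) (s≤s z≤n))
  minHead (suc j) x v le eq = trans (G-suc j (minHead j) (x ∷ v) le)
    (cong (λ c → if c then minFirsts t (first j (minHead j)) v else + 0) eq)

  totalG-full : ∀ j → totalG (s * suc j) (suc j) ≡ + suc (s * j) ℤ.* - totalG (s * j) j
  totalG-full j = begin
    totalG (s * suc j) (suc j)
      ≡⟨ cong (λ n → totalG n (suc j)) (trans (ℕₚ.*-suc s j) (sym (trans (ℕₚ.+-suc e (suc (s * j))) (cong suc (ℕₚ.+-suc e (s * j)))))) ⟩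
    totalG (e + suc (suc (s * j))) (suc j)
      ≡⟨ totalG-step j (minHead j) (suc (s * j)) (ℕₚ.n≤1+n (s * j)) ⟩
    total (rest j (minHead j)) (suc (s * j)) ℤ.+ total (rest j (minHead j)) (2 + s * j)
      ≡⟨ cong₂ ℤ._+_ (total-rest j (minHead j) (s * j)) (total-rest j (minHead j) (suc (s * j))) ⟩
    + suc (s * j) ℤ.* - totalG (s * j) j ℤ.+ + (2 + s * j) ℤ.* - totalG (suc (s * j)) j
      -- A first brick of length `s - 1` would leave `s * j + 1` letters, one too many for `j`
      -- bricks.
      ≡⟨ cong (λ z → + suc (s * j) ℤ.* - totalG (s * j) j ℤ.+ + (2 + s * j) ℤ.* - z) tooLong ⟩
    + suc (s * j) ℤ.* - totalG (s * j) j ℤ.+ + (2 + s * j) ℤ.* + 0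
      ≡⟨ cong (ℤ._+_ (+ suc (s * j) ℤ.* - totalG (s * j) j)) (ℤₚ.*-zeroʳ (+ (2 + s * j))) ⟩
    + suc (s * j) ℤ.* - totalG (s * j) j ℤ.+ + 0
      ≡⟨ ℤₚ.+-identityʳ _ ⟩
    + suc (s * j) ℤ.* - totalG (s * j) j ∎
    where
    tooLong : totalG (suc (s * j)) j ≡ + 0
    tooLong = trans (total-length-cong (suc (s * j)) (λ w len → G-vanish w j (ℕₚ.≤-reflexive (sym len))))
                    (total-0 (suc (s * j)))

  totalG-short-zero : totalG (suc e) 1 ≡ - + 1
  totalG-short-zero = begin
    totalG (suc e) 1
      ≡⟨ cong (λ n → totalG n 1) (ℕₚ.+-comm 1 e) ⟩
    totalG (e + 1) 1
      ≡⟨ totalG-step 0 (minHead 0) 0 (ℕₚ.≤-reflexive (ℕₚ.*-zeroʳ s)) ⟩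
    + 0 ℤ.+ total (rest 0 (minHead 0)) 1
      ≡⟨ cong (ℤ._+_ (+ 0)) (total-rest 0 (minHead 0) 0) ⟩
    - + 1 ∎

  -- Exactly one brick is a letter short. A full first brick leaves a word of the same kind; a short
  -- first brick leaves one made of full bricks. The factors count the values of the first brick's
  -- last letter.
  totalG-short-suc : ∀ j → totalG (s * suc j + suc e) (2 + j) ≡
    + (s * suc j) ℤ.* - totalG (s * j + suc e) (suc j) ℤ.+ + suc (s * suc j) ℤ.* - totalG (s * suc j) (suc j)
  totalG-short-suc j = begin
    totalG (s * suc j + suc e) (2 + j)
      ≡⟨ cong (λ n → totalG n (2 + j)) (trans (ℕₚ.+-suc (s * suc j) e) (ℕₚ.+-comm (suc (s * suc j)) e)) ⟩
    totalG (e + suc (s * suc j)) (2 + j)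
      ≡⟨ totalG-step (suc j) (minHead (suc j)) (s * suc j) ≤-refl ⟩
    total R (s * suc j) ℤ.+ total R (suc (s * suc j))
      ≡⟨ cong₂ ℤ._+_ (trans (cong (total R) unfold) (trans (total-rest (suc j) (minHead (suc j)) (s * j + suc e))
            (cong (λ n → + n ℤ.* - totalG (s * j + suc e) (suc j)) (sym unfold))))
          (total-rest (suc j) (minHead (suc j)) (s * suc j)) ⟩
    + (s * suc j) ℤ.* - totalG (s * j + suc e) (suc j) ℤ.+ + suc (s * suc j) ℤ.* - totalG (s * suc j) (suc j) ∎
    where
    R : List ℕ → ℤ
    R = rest (suc j) (minHead (suc j))
    unfold : s * suc j ≡ suc (s * j + suc e)
    unfold = trans (ℕₚ.*-suc s j) (trans (ℕₚ.+-comm s (s * j)) (ℕₚ.+-suc (s * j) (suc e)))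

-- Signs and closed products

sign : ℕ → ℤ
sign zero    = + 1
sign (suc n) = - sign n

atNeg-sign : ∀ p n → atNeg p n ≡ sign n ℤ.* p n
atNeg-sign p zero    = sym (ℤₚ.*-identityˡ (p 0))
atNeg-sign p (suc n) = trans (cong -_ (atNeg-sign (λ k → p (suc k)) n)) (ℤₚ.neg-distribˡ-* (sign n) (p (suc n)))

fullProduct shortProduct : ℕ → ℕ → ℕ
fullProduct  s n = prodFrom1 n (λ i → (i ∸ 1) * s + 1)
shortProduct s n = prodFrom1 n (λ i → (i + 1) * s + 1)

-- The full product runs through `1, s + 1, 2s + 1, ...`, and the short one is its tail from
-- `2s + 1` on.
fullProduct≡shortProduct : ∀ s n → fullProduct s (2 + n) ≡ (s + 1) * shortProduct s n
fullProduct≡shortProduct s zero    = lem s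
  where
  lem : ∀ s → (1 * (0 * s + 1)) * (1 * s + 1) ≡ (s + 1) * 1
  lem = ℕ-Solver.solve-∀
fullProduct≡shortProduct s (suc n) = begin
  fullProduct s (2 + n) * ((2 + n) * s + 1)               ≡⟨ cong (_* ((2 + n) * s + 1)) (fullProduct≡shortProduct s n) ⟩
  (s + 1) * shortProduct s n * ((2 + n) * s + 1)          ≡⟨ lem s (shortProduct s n) n ⟩
  (s + 1) * (shortProduct s n * ((suc n + 1) * s + 1))    ∎
  where
  lem : ∀ s c n → (s + 1) * c * ((2 + n) * s + 1) ≡ (s + 1) * (c * ((suc n + 1) * s + 1))
  lem = ℕ-Solver.solve-∀

-- The recursion of `totalG-short-suc` without signs. As `suc (s * suc n)` is the next factor of the
-- full product, both summands are multiples of `shortProduct s n`, with coefficients adding up to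
-- its next factor.
shortProduct-suc : ∀ s n →
  s * suc n * shortProduct s n + suc (s * suc n) * fullProduct s (suc n) ≡ shortProduct s (suc n)
shortProduct-suc s n = begin
  s * suc n * c + suc (s * suc n) * fullProduct s (suc n)
    ≡⟨ cong (_+_ (s * suc n * c)) (comm s n (fullProduct s (suc n))) ⟩
  s * suc n * c + fullProduct s (2 + n)
    ≡⟨ cong (_+_ (s * suc n * c)) (fullProduct≡shortProduct s n) ⟩
  s * suc n * c + (s + 1) * c
    ≡⟨ collect s n c ⟩
  c * ((suc n + 1) * s + 1) ∎
  where
  c : ℕ
  c = shortProduct s n
  comm : ∀ s n f → suc (s * suc n) * f ≡ f * (suc n * s + 1)
  comm = ℕ-Solver.solve-∀
  collect : ∀ s n c → s * suc n * c + (s + 1) * c ≡ c * ((suc n + 1) * s + 1)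
  collect = ℕ-Solver.solve-∀

module _ (t : ℕ) where
  open Extremal t
  open Bricks e using (totalG)

  full : ∀ n → sign n ℤ.* totalG (s * n) n ≡ + fullProduct s n
  full zero    = cong (λ k → + 1 ℤ.* totalG k 0) (ℕₚ.*-zeroʳ s)
  full (suc n) = begin
    - sign n ℤ.* totalG (s * suc n) (suc n)               ≡⟨ cong (ℤ._*_ (- sign n)) (totalG-full n) ⟩
    - sign n ℤ.* (+ suc (s * n) ℤ.* - totalG (s * n) n)   ≡⟨ lem (sign n) (+ suc (s * n)) (totalG (s * n) n) ⟩
    + suc (s * n) ℤ.* (sign n ℤ.* totalG (s * n) n)       ≡⟨ cong (ℤ._*_ (+ suc (s * n))) (full n) ⟩
    + suc (s * n) ℤ.* + fullProduct s n                   ≡⟨ ℤₚ.pos-* (suc (s * n)) (fullProduct s n) ⟨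
    + (suc (s * n) * fullProduct s n)                     ≡⟨ cong +_ (comm s n (fullProduct s n)) ⟩
    + (fullProduct s n * (n * s + 1))                     ∎
    where
    lem : ∀ g c u → - g ℤ.* (c ℤ.* - u) ≡ c ℤ.* (g ℤ.* u)
    lem = solve-∀
    comm : ∀ s n f → suc (s * n) * f ≡ f * (n * s + 1)
    comm = ℕ-Solver.solve-∀

  short : ∀ n → sign (suc n) ℤ.* totalG (s * n + suc e) (suc n) ≡ + shortProduct s n
  short zero    = trans (cong (λ k → - + 1 ℤ.* totalG (k + suc e) 1) (ℕₚ.*-zeroʳ s)) (cong (ℤ._*_ (- + 1)) totalG-short-zero)
  short (suc n) = begin
    - σ ℤ.* totalG (s * suc n + suc e) (2 + n)
      ≡⟨ cong (ℤ._*_ (- σ)) (totalG-short-suc n) ⟩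
    - σ ℤ.* (+ (s * suc n) ℤ.* - u ℤ.+ + suc (s * suc n) ℤ.* - v)
      ≡⟨ lem σ (+ (s * suc n)) u (+ suc (s * suc n)) v ⟩
    + (s * suc n) ℤ.* (σ ℤ.* u) ℤ.+ + suc (s * suc n) ℤ.* (σ ℤ.* v)
      ≡⟨ cong₂ (λ x y → + (s * suc n) ℤ.* x ℤ.+ + suc (s * suc n) ℤ.* y) (short n) (full (suc n)) ⟩
    + (s * suc n) ℤ.* + shortProduct s n ℤ.+ + suc (s * suc n) ℤ.* + fullProduct s (suc n)
      ≡⟨ cong₂ ℤ._+_ (ℤₚ.pos-* (s * suc n) (shortProduct s n)) (ℤₚ.pos-* (suc (s * suc n)) (fullProduct s (suc n))) ⟨
    + (s * suc n * shortProduct s n + suc (s * suc n) * fullProduct s (suc n))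
      ≡⟨ cong +_ (shortProduct-suc s n) ⟩
    + shortProduct s (suc n) ∎
    where
    σ u v : ℤ
    σ = sign (suc n)
    u = totalG (s * n + suc e) (suc n)
    v = totalG (s * suc n) (suc n)
    lem : ∀ g a u b v → - g ℤ.* (a ℤ.* - u ℤ.+ b ℤ.* - v) ≡ a ℤ.* (g ℤ.* u) ℤ.+ b ℤ.* (g ℤ.* v)
    lem = solve-∀

  U≐ : ∀ n → U (Γ₂₂ s) n ≐ totalG n
  U≐ = U≐totalG e (Γ₂₂ s) (A≐totalF e)

theorem6 : ∀ (s : ℕ) → 3 ≤ s → ∀ (n : ℕ) → 1 ≤ n →
    (atNeg (U (Γ₂₂ s) (s * n)) n ≡ + prodFrom1 n (λ i → (i ∸ 1) * s + 1))
    × (atNeg (U (Γ₂₂ s) (s * n + s ∸ 1)) (suc n) ≡ + prodFrom1 n (λ i → (i + 1) * s + 1))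
theorem6 s@(suc (suc (suc t))) (s≤s (s≤s (s≤s z≤n))) n _ = fullCase , shortCase
  where
  fullCase : atNeg (U (Γ₂₂ s) (s * n)) n ≡ + fullProduct s n
  fullCase = begin
    atNeg (U (Γ₂₂ s) (s * n)) n             ≡⟨ atNeg-sign (U (Γ₂₂ s) (s * n)) n ⟩
    sign n ℤ.* U (Γ₂₂ s) (s * n) n          ≡⟨ cong (ℤ._*_ (sign n)) (U≐ t (s * n) n) ⟩
    sign n ℤ.* Bricks.totalG (suc t) (s * n) n   ≡⟨ full t n ⟩
    + fullProduct s n                       ∎
  shortCase : atNeg (U (Γ₂₂ s) (s * n + s ∸ 1)) (suc n) ≡ + shortProduct s n
  shortCase = begin
    atNeg (U (Γ₂₂ s) (s * n + s ∸ 1)) (suc n)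
      -- Moving the successor of `s` outwards lets the truncated subtraction compute.
      ≡⟨ cong (λ m → atNeg (U (Γ₂₂ s) (m ∸ 1)) (suc n)) (ℕₚ.+-suc (s * n) (2 + t)) ⟩
    atNeg (U (Γ₂₂ s) (s * n + (2 + t))) (suc n)
      ≡⟨ atNeg-sign (U (Γ₂₂ s) (s * n + (2 + t))) (suc n) ⟩
    sign (suc n) ℤ.* U (Γ₂₂ s) (s * n + (2 + t)) (suc n)
      ≡⟨ cong (ℤ._*_ (sign (suc n))) (U≐ t (s * n + (2 + t)) (suc n)) ⟩
    sign (suc n) ℤ.* Bricks.totalG (suc t) (s * n + (2 + t)) (suc n)
      ≡⟨ short t n ⟩
    + shortProduct s n ∎
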